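{- For every $n\ge 2$, $\mu(S_3^n)=3^{n-2}+3$. Moreover, if $n\ge 4$ and $X$ is a mutual-visibility set of $S_3^n$ with $|X|=3^{n-2}+3$, then $|X\cap V(iS_3^{n-1})|=3^{n-3}+1$ for every $i\in\{0,1,2\}$. In addition, if $n\ge 4$ and $X$ is any mutual-visibility set of $S_3^n$, then $|X\cap(V(iS_3^{n-1})\cup V(jS_3^{n-1}))|\le 2\cdot 3^{n-3}+4$ for all $i,j\in\{0,1,2\}$.
   Context: The Sierpiński graph $S_3^n$ ($n\ge1$) has vertex set $\{0,1,2\}^n$ (vertices written as words $i_1\cdots i_n$), and $i_1\cdots i_n$ is adjacent to $j_1\cdots j_n$ iff there is $h\in\{1,\dots,n\}$ with $i_t=j_t$ for all $t<h$, $i_h\ne j_h$, and $i_t=j_h$, $j_t=i_h$ for all $t>h$. For $i\in\{0,1,2\}$, $iS_3^{n-1}$ denotes the subgraph of $S_3^n$ induced by the vertices $it$, $t\in\{0,1,2\}^{n-1}$. For a graph $G$ and $X\subseteq V(G)$, $u,v$ are $X$-visible if some shortest $u,v$-path $P$ has $V(P)\cap X\subseteq\{u,v\}$; $X$ is a mutual-visibility set if any two vertices of $X$ are $X$-visible; $\mu(G)$ is the maximum size of such a set. -}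

module Defs where

open import Data.Nat using (ℕ; zero; suc; _≤_)
open import Data.Fin using (Fin; _<_)
open import Data.Fin.Properties using (_≟_)
open import Data.Vec using (Vec; []; _∷_; lookup)
open import Data.List using (List; []; _∷_; length; filter)
open import Data.List.Membership.Propositional using (_∈_)
open import Data.List.Relation.Unary.Unique.Propositional using (Unique)
open import Data.Product using (Σ; _×_; ∃; _,_)
open import Data.Sum using (_⊎_)
open import Data.Empty using (⊥)
open import Relation.Nullary using (¬_; Dec; yes; no)
open import Relation.Nullary.Decidable using (_⊎-dec_)
open import Relation.Binary.PropositionalEquality using (_≡_; _≢_)

data Walk {V : Set} (Adj : V → V → Set) : V → V → Set where
  []  : ∀ {u} → Walk Adj u u
  _∷_ : ∀ {u w v} → Adj u w → Walk Adj w v → Walk Adj u v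

walkLength : ∀ {V Adj} {u v : V} → Walk Adj u v → ℕ
walkLength []      = 0
walkLength (_ ∷ p) = suc (walkLength p)

walkVertices : ∀ {V Adj} {u v : V} → Walk Adj u v → List V
walkVertices {u = u} []      = u ∷ []
walkVertices {u = u} (_ ∷ p) = u ∷ walkVertices p

-- a shortest u,v-path: a u,v-walk of minimum length (automatically a path)
IsShortest : ∀ {V Adj} {u v : V} → Walk Adj u v → Set
IsShortest {Adj = Adj} {u} {v} P = ∀ (Q : Walk Adj u v) → walkLength P ≤ walkLength Q

Visible : ∀ {V} (Adj : V → V → Set) → List V → V → V → Set
Visible Adj X u v =
  Σ (Walk Adj u v) λ P → IsShortest P ×
    (∀ w → w ∈ walkVertices P → w ∈ X → (w ≡ u ⊎ w ≡ v))

IsMutualVisibilitySet : ∀ {V} (Adj : V → V → Set) → List V → Set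
IsMutualVisibilitySet Adj X = ∀ u v → u ∈ X → v ∈ X → Visible Adj X u v

IsMu : ∀ {V} (Adj : V → V → Set) → ℕ → Set
IsMu {V} Adj k =
  (Σ (List V) λ X → Unique X × IsMutualVisibilitySet Adj X × length X ≡ k)
  × (∀ (X : List V) → Unique X → IsMutualVisibilitySet Adj X → length X ≤ k)

SVertex : ℕ → Set
SVertex n = Vec (Fin 3) n

SAdj : (n : ℕ) → SVertex n → SVertex n → Set
SAdj n u v =
  Σ (Fin n) λ h →
    (∀ t → t < h → lookup u t ≡ lookup v t) ×
    (lookup u h ≢ lookup v h) ×
    (∀ t → h < t → (lookup u t ≡ lookup v h) × (lookup v t ≡ lookup u h))

InCopy : ∀ {n} → Fin 3 → SVertex n → Set
InCopy i []      = ⊥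
InCopy i (x ∷ _) = x ≡ i

inCopy? : ∀ {n} (i : Fin 3) (v : SVertex n) → Dec (InCopy i v)
inCopy? i []      = no λ ()
inCopy? i (x ∷ _) = x ≟ i

countCopy : ∀ {n} → Fin 3 → List (SVertex n) → ℕ
countCopy i X = length (filter (inCopy? i) X)

countTwoCopies : ∀ {n} → Fin 3 → Fin 3 → List (SVertex n) → ℕ
countTwoCopies i j X = length (filter (λ v → inCopy? i v ⊎-dec inCopy? j v) X)

{-# OPTIONS --safe #-}
module Submission where

-- Let g = 3^(m-2). A mutual-visibility set f of S^m, seen as a copy inside S^(m+1),
-- has to see the corners through which it meets the other copies, and the sides used
-- by the traffic of other copies must avoid it. Each requirement lowers the bound:
-- 3 + g without any, 2 + g if f sees one corner, 1 + g if it sees two, and g if it sees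
-- all three and two of its sides are clear. In S^(m+1) with three inhabited copies each
-- copy sees two corners, so the total is at most 3 (1 + g) = 3 + 3 g, and the other
-- three bounds are inherited in the same way. Two vertices may also meet only by a
-- detour through the third copy; then all vertices of one of the copies lie nearer to
-- the third copy, and this costs more than the detour gains. The induction starts from
-- an exhaustive search in S³. The bound is attained by the words ending in 012, 120 or
-- 201 together with the three corners.

open import Defs
open import Data.Bool using (Bool; true; false; _∧_; _∨_; T; if_then_else_)
import Data.Bool.Properties as Bool
open import Data.Empty using (⊥; ⊥-elim)
open import Data.Fin using (Fin; zero; suc)
open import Data.Fin.Properties using (_≟_; all?)
open import Data.List using (List; []; _∷_; _++_; map; length; filter; filterᵇ)
open import Data.List.Membership.Propositional using (_∈_)
open import Data.List.Membership.Propositional.Properties using (∈-filter⁺; ∈-filter⁻; ∈-map⁻; ∈-++⁻)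
open import Data.List.Properties using (filter-≐)
import Data.List.Relation.Unary.AllPairs as AllPairs
open import Data.List.Relation.Unary.All as All using (All; []; _∷_)
open import Data.List.Relation.Unary.Any using (here; there; any?)
open import Data.List.Relation.Unary.Unique.Propositional using (Unique)
import Data.List.Relation.Unary.Unique.Propositional.Properties as Unique
open import Data.Nat using (ℕ; zero; suc; _≤_; _<_; _+_; _*_; _∸_; _^_; z≤n; s≤s; _≤?_; _<ᵇ_)
open import Data.Nat.Properties hiding (_≟_)
open import Data.Nat.Tactic.RingSolver using (solve-∀)
open import Data.Product using (Σ; _×_; ∃; _,_; proj₁; proj₂)
open import Data.Sum as Sum using (_⊎_; inj₁; inj₂; [_,_]′; reduce)
open import Data.Unit using (⊤; tt)
open import Data.Vec as Vec using (Vec; []; _∷_; replicate)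
import Data.Vec.Properties as Vec
open import Function using (_∘_; module Equivalence)
open import Relation.Nullary using (¬_; Dec; yes; no; does)
open import Relation.Nullary.Decidable using (_⊎-dec_; _×-dec_; _→-dec_; ¬?; dec-true; dec-false; from-yes)
open import Relation.Unary using (Decidable)
open import Relation.Binary.PropositionalEquality

-- Vertex sets and visibility

-- `Visible` ranges over all walks, whereas the counting needs a recursion over copies. So `Vis`
-- names the few candidate paths letter by letter, and an edge-by-edge comparison with arbitrary
-- walks shows that the two notions agree. The weaker bounds reproduce themselves because the copies
-- inherit different demands: 2 + 3g = g + 2 (1 + g), where the copy at the seen corner carries the
-- traffic of the others; 1 + 3g = (1 + g) + 2g with two such copies; 3g = g + g + g. The start is
-- S³ and not S²: for g = 1 two inhabited copies are allowed 4 + 2g = 6 vertices, more than 2 + 3g =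
-- 5, and the step needs `3 ≤ g`. A detour is costly because crossing the third copy takes `2 ^ m`,
-- more than one end alone can save.

pattern 0F = zero
pattern 1F = suc zero
pattern 2F = suc (suc zero)

data Perm : Fin 3 → Fin 3 → Fin 3 → Set where
  p012 : Perm 0F 1F 2F
  p021 : Perm 0F 2F 1F
  p102 : Perm 1F 0F 2F
  p120 : Perm 1F 2F 0F
  p201 : Perm 2F 0F 1F
  p210 : Perm 2F 1F 0F

third : Fin 3 → Fin 3 → Fin 3
third 0F 1F = 2F
third 0F 2F = 1F
third 1F 0F = 2F
third 1F 2F = 0F
third 2F 0F = 1F
third 2F 1F = 0F
third i  _  = i  -- junk value

third-perm : ∀ {i j} → i ≢ j → Perm i j (third i j)
third-perm {0F} {0F} n = ⊥-elim (n refl)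
third-perm {0F} {1F} n = p012
third-perm {0F} {2F} n = p021
third-perm {1F} {0F} n = p102
third-perm {1F} {1F} n = ⊥-elim (n refl)
third-perm {1F} {2F} n = p120
third-perm {2F} {0F} n = p201
third-perm {2F} {1F} n = p210
third-perm {2F} {2F} n = ⊥-elim (n refl)

perm-third : ∀ {i j k} → Perm i j k → third i j ≡ k
perm-third p012 = refl
perm-third p021 = refl
perm-third p102 = refl
perm-third p120 = refl
perm-third p201 = refl
perm-third p210 = refl

swap₁₂ : ∀ {i j k} → Perm i j k → Perm j i k
swap₁₂ p012 = p102
swap₁₂ p021 = p201
swap₁₂ p102 = p012
swap₁₂ p120 = p210
swap₁₂ p201 = p021
swap₁₂ p210 = p120

swap₂₃ : ∀ {i j k} → Perm i j k → Perm i k j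
swap₂₃ p012 = p021
swap₂₃ p021 = p012
swap₂₃ p102 = p120
swap₂₃ p120 = p102
swap₂₃ p201 = p210
swap₂₃ p210 = p201

rotate : ∀ {i j k} → Perm i j k → Perm j k i
rotate = swap₂₃ ∘ swap₁₂

kij : ∀ {i j k} → Perm i j k → Perm k i j
kij = rotate ∘ rotate

kji : ∀ {i j k} → Perm i j k → Perm k j i
kji = swap₁₂ ∘ rotate

perm-≢ : ∀ {i j k} → Perm i j k → i ≢ j
perm-≢ p012 ()
perm-≢ p021 ()
perm-≢ p102 ()
perm-≢ p120 ()
perm-≢ p201 ()
perm-≢ p210 ()

perm-last : ∀ {i j k l} → Perm i j k → l ≢ i → l ≢ j → l ≡ k
perm-last {l = 0F} p012 a b = ⊥-elim (a refl)
perm-last {l = 1F} p012 a b = ⊥-elim (b refl)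
perm-last {l = 2F} p012 a b = refl
perm-last {l = 0F} p021 a b = ⊥-elim (a refl)
perm-last {l = 1F} p021 a b = refl
perm-last {l = 2F} p021 a b = ⊥-elim (b refl)
perm-last {l = 0F} p102 a b = ⊥-elim (b refl)
perm-last {l = 1F} p102 a b = ⊥-elim (a refl)
perm-last {l = 2F} p102 a b = refl
perm-last {l = 0F} p120 a b = refl
perm-last {l = 1F} p120 a b = ⊥-elim (a refl)
perm-last {l = 2F} p120 a b = ⊥-elim (b refl)
perm-last {l = 0F} p201 a b = ⊥-elim (b refl)
perm-last {l = 1F} p201 a b = refl
perm-last {l = 2F} p201 a b = ⊥-elim (a refl)
perm-last {l = 0F} p210 a b = refl
perm-last {l = 1F} p210 a b = ⊥-elim (b refl)
perm-last {l = 2F} p210 a b = ⊥-elim (a refl)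

VSet : ℕ → Set
VSet m = SVertex m → Bool

infix 4 _∈ˢ_
_∈ˢ_ : ∀ {m} → SVertex m → VSet m → Set
v ∈ˢ f = f v ≡ true

copy : ∀ {m} → Fin 3 → VSet (suc m) → VSet m
copy i f t = f (i ∷ t)

count : ∀ {m} → VSet m → ℕ
count {zero}  f = if f [] then 1 else 0
count {suc m} f = count (copy 0F f) + (count (copy 1F f) + count (copy 2F f))

corner : (m : ℕ) → Fin 3 → SVertex m
corner m c = replicate m c

-- The distance to the corner `c…c`, in binary: the digits 1 stand where the letters differ from
-- `c`.
dist : ∀ {m} → Fin 3 → SVertex m → ℕ
dist c [] = 0
dist {suc m} c (i ∷ t) = (if does (i ≟ c) then 0 else 2 ^ m) + dist c t

-- The shortest path between the corners `a…a` and `b…b` runs through exactly the words over the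
-- letters `a` and `b`; it has to avoid `f`, ends included.
Side : ∀ {m} → VSet m → Fin 3 → Fin 3 → Set
Side {zero}  f a b = f [] ≡ false
Side {suc m} f a b = Side (copy a f) a b × Side (copy b f) a b

-- No vertex after t on the path from t to the corner c…c lies in f; that path is
-- the unique shortest one and leaves the copy i ≢ c through the corner i c…c.
Sees : ∀ {m} → VSet m → Fin 3 → SVertex m → Set
Sees f c []      = ⊤
Sees f c (i ∷ t) = Sees (copy i f) c t × (i ≢ c → Side (copy c f) i c)

-- i t and j s are joined by at most two shortest paths: over the edge between the
-- copies i and j, or along a side of copy k; the inequality compares their lengths.
Direct : ∀ {m} → VSet (suc m) → (i j k : Fin 3) → SVertex m → SVertex m → Set
Direct {m} f i j k t s =
  dist j t + dist i s ≤ dist k t + dist k s + 2 ^ m ×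
  Sees (copy i f) j t × Sees (copy j f) i s

Via : ∀ {m} → VSet (suc m) → (i j k : Fin 3) → SVertex m → SVertex m → Set
Via {m} f i j k t s =
  dist k t + dist k s + 2 ^ m ≤ dist j t + dist i s ×
  Sees (copy i f) k t × Sees (copy j f) k s × Side (copy k f) i j

Vis : ∀ {m} → VSet m → SVertex m → SVertex m → Set
Vis f []      []      = ⊤
Vis f (i ∷ t) (j ∷ s) =
  (i ≡ j → Vis (copy i f) t s) ×
  (i ≢ j → Direct f i j (third i j) t s ⊎ Via f i j (third i j) t s)

MV : ∀ {m} → VSet m → Set
MV f = ∀ u v → u ∈ˢ f → v ∈ˢ f → Vis f u v

side? : ∀ {m} (f : VSet m) a b → Dec (Side f a b)
side? {zero}  f a b = f [] Bool.≟ false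
side? {suc m} f a b = side? (copy a f) a b ×-dec side? (copy b f) a b

sees? : ∀ {m} (f : VSet m) c t → Dec (Sees f c t)
sees? f c []      = yes tt
sees? f c (i ∷ t) = sees? (copy i f) c t ×-dec (¬? (i ≟ c) →-dec side? (copy c f) i c)

vis? : ∀ {m} (f : VSet m) u v → Dec (Vis f u v)
vis? f []      []      = yes tt
vis? {suc m} f (i ∷ t) (j ∷ s) =
  ((i ≟ j) →-dec vis? (copy i f) t s) ×-dec
  (¬? (i ≟ j) →-dec
    (((dist j t + dist i s ≤? dist k t + dist k s + 2 ^ m) ×-dec
        (sees? (copy i f) j t ×-dec sees? (copy j f) i s))
     ⊎-dec
     ((dist k t + dist k s + 2 ^ m ≤? dist j t + dist i s) ×-dec
        (sees? (copy i f) k t ×-dec (sees? (copy j f) k s ×-dec side? (copy k f) i j)))))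
  where k = third i j

infix 4 _⊆ˢ_
_⊆ˢ_ : ∀ {m} → VSet m → VSet m → Set
f ⊆ˢ h = ∀ v → v ∈ˢ f → v ∈ˢ h

∉-⊆ : ∀ {m} {f h : VSet m} → f ⊆ˢ h → ∀ v → h v ≡ false → f v ≡ false
∉-⊆ {f = f} s v p with f v in eq
... | false = refl
... | true  = trans (sym (s v eq)) p

side-⊆ : ∀ {m} {f h : VSet m} → f ⊆ˢ h → ∀ {a b} → Side h a b → Side f a b
side-⊆ {zero}  s p = ∉-⊆ s [] p
side-⊆ {suc m} s (p , q) = side-⊆ (s ∘ (_ ∷_)) p , side-⊆ (s ∘ (_ ∷_)) q

sees-⊆ : ∀ {m} {f h : VSet m} → f ⊆ˢ h → ∀ {c} t → Sees h c t → Sees f c t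
sees-⊆ s []      p = tt
sees-⊆ s (i ∷ t) (p , q) = sees-⊆ (s ∘ (i ∷_)) t p , λ n → side-⊆ (s ∘ (_ ∷_)) (q n)

vis-⊆ : ∀ {m} {f h : VSet m} → f ⊆ˢ h → ∀ u v → Vis h u v → Vis f u v
vis-⊆ s []      []      p = tt
vis-⊆ {f = f} {h} s (i ∷ t) (j ∷ r) (p , q) =
  (λ e → vis-⊆ (s ∘ (i ∷_)) t r (p e)) , λ n → cross (q n)
  where
  cross : ∀ {k} → Direct h i j k t r ⊎ Via h i j k t r → Direct f i j k t r ⊎ Via f i j k t r
  cross (inj₁ (l , a , b)) = inj₁ (l , sees-⊆ (s ∘ (i ∷_)) t a , sees-⊆ (s ∘ (j ∷_)) r b)
  cross (inj₂ (l , a , b , c)) =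
    inj₂ (l , sees-⊆ (s ∘ (i ∷_)) t a , sees-⊆ (s ∘ (j ∷_)) r b , side-⊆ (s ∘ (_ ∷_)) c)

side-sym : ∀ {m} {f : VSet m} {a b} → Side f a b → Side f b a
side-sym {zero}  p = p
side-sym {suc m} (p , q) = side-sym q , side-sym p

vis-same : ∀ {m} {f : VSet (suc m)} {i t s} → Vis f (i ∷ t) (i ∷ s) → Vis (copy i f) t s
vis-same (p , _) = p refl

vis-cross : ∀ {m} {f : VSet (suc m)} {i j k t s} → Perm i j k →
  Vis f (i ∷ t) (j ∷ s) → Direct f i j k t s ⊎ Via f i j k t s
vis-cross p (_ , q) with refl ← perm-third p = q (perm-≢ p)

-- Distances to the corners

dist-same : ∀ {m} c (t : SVertex m) → dist c (c ∷ t) ≡ dist c t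
dist-same 0F t = refl
dist-same 1F t = refl
dist-same 2F t = refl

dist-diff : ∀ {m i c} → i ≢ c → (t : SVertex m) → dist c (i ∷ t) ≡ 2 ^ m + dist c t
dist-diff {i = i} {c} n t with i ≟ c
... | yes e = ⊥-elim (n e)
... | no _  = refl

2^-split : ∀ m → 2 ^ suc m ≡ 2 ^ m + 2 ^ m
2^-split m = cong (2 ^ m +_) (+-identityʳ (2 ^ m))

dist-< : ∀ {m} c (t : SVertex m) → dist c t < 2 ^ m
dist-< c [] = s≤s z≤n
dist-< {suc m} c (i ∷ t) with i ≟ c
... | yes _ = ≤-trans (dist-< c t) (m≤m+n (2 ^ m) _)
... | no _  = subst (2 ^ m + dist c t <_) (sym (2^-split m)) (+-monoʳ-< (2 ^ m) (dist-< c t))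

-- Exhaustive search

_≟ᵛ_ : ∀ {m} (u v : SVertex m) → Dec (u ≡ v)
_≟ᵛ_ = Vec.≡-dec _≟_

among : ∀ {m} → List (SVertex m) → VSet m
among L v = does (any? (v ≟ᵛ_) L)

among-∈ : ∀ {m} {L : List (SVertex m)} {v} → v ∈ˢ among L → v ∈ L
among-∈ {L = L} {v} p with any? (v ≟ᵛ_) L
... | yes q = q

vertices : ∀ m → List (SVertex m)
vertices zero    = [] ∷ []
vertices (suc m) = map (0F ∷_) (vertices m) ++ map (1F ∷_) (vertices m) ++ map (2F ∷_) (vertices m)

filterᵇ-map : ∀ {A B : Set} (p : B → Bool) (g : A → B) xs →
  length (filterᵇ p (map g xs)) ≡ length (filterᵇ (p ∘ g) xs)
filterᵇ-map p g []       = refl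
filterᵇ-map p g (x ∷ xs) with p (g x)
... | true  = cong suc (filterᵇ-map p g xs)
... | false = filterᵇ-map p g xs

filterᵇ-++ : ∀ {A : Set} (p : A → Bool) xs ys →
  length (filterᵇ p (xs ++ ys)) ≡ length (filterᵇ p xs) + length (filterᵇ p ys)
filterᵇ-++ p []       ys = refl
filterᵇ-++ p (x ∷ xs) ys with p x
... | true  = cong suc (filterᵇ-++ p xs ys)
... | false = filterᵇ-++ p xs ys

count-vertices : ∀ {m} (f : VSet m) → count f ≡ length (filterᵇ f (vertices m))
count-vertices {zero} f with f []
... | true  = refl
... | false = refl
count-vertices {suc m} f = sym (begin
  length (filterᵇ f (xs 0F ++ xs 1F ++ xs 2F))
    ≡⟨ filterᵇ-++ f (xs 0F) _ ⟩
  length (filterᵇ f (xs 0F)) + length (filterᵇ f (xs 1F ++ xs 2F))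
    ≡⟨ cong₂ _+_ (part 0F) (trans (filterᵇ-++ f (xs 1F) _) (cong₂ _+_ (part 1F) (part 2F))) ⟩
  count f ∎)
  where
  open ≡-Reasoning
  xs = λ i → map (i ∷_) (vertices m)
  part : ∀ i → length (filterᵇ f (xs i)) ≡ count (copy i f)
  part i = trans (filterᵇ-map f (i ∷_) (vertices m)) (sym (count-vertices (copy i f)))

true⊎false : ∀ b → b ≡ true ⊎ b ≡ false
true⊎false true  = inj₁ refl
true⊎false false = inj₂ refl

-- Mutual visibility and R are inherited by subsets, so a branch can be cut as soon as
-- the chosen vertices fail them. search k L ws refutes that k further vertices of ws
-- can be added to L.
module Search {m} (R : VSet m → SVertex m → Set) (R? : ∀ f v → Dec (R f v))
  (R-⊆ : ∀ {f h} → f ⊆ˢ h → ∀ v → R h v → R f v) where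

  -- Adding `w` can block `v` from `L`, hence these pairs are tested in the larger set. Pairs inside
  -- `L` are not tested again: the test is a necessary condition only.
  Compatible : (v : SVertex m) (L : List (SVertex m)) (w : SVertex m) → Set
  Compatible v L w =
    All (R F) (w ∷ v ∷ L) × All (Vis F w) (v ∷ L) × All (Vis F v) L
    where F = among (w ∷ v ∷ L)

  compatible? : ∀ v L w → Dec (Compatible v L w)
  compatible? v L w =
    All.all? (R? F) (w ∷ v ∷ L) ×-dec (All.all? (vis? F w) (v ∷ L) ×-dec All.all? (vis? F v) L)
    where F = among (w ∷ v ∷ L)

  search : ℕ → List (SVertex m) → List (SVertex m) → Bool
  search zero    L ws       = false
  search (suc k) L []       = true
  search (suc k) L (v ∷ ws) =
    -- Even with `v`, at most `k` candidates are left.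
    if length ws <ᵇ k then true
    else search k (v ∷ L) (filterᵇ (does ∘ compatible? v L) ws) ∧ search (suc k) L ws

  search-step : ∀ {k L v} ws → search (suc k) L (v ∷ ws) ≡ true →
    length ws < k ⊎
    search k (v ∷ L) (filterᵇ (does ∘ compatible? v L) ws) ≡ true × search (suc k) L ws ≡ true
  search-step {k} {L} {v} ws s with length ws <ᵇ k in eq
  ... | true = inj₁ (<ᵇ⇒< (length ws) k (subst T (sym eq) tt))
  ... | false with search k (v ∷ L) (filterᵇ (does ∘ compatible? v L) ws)
  ...   | true = inj₂ (refl , s)

  module _ (f : VSet m) (mv : MV f) (r : ∀ v → v ∈ˢ f → R f v) where

    compatible : ∀ {v L w} → All (_∈ˢ f) (v ∷ L) → w ∈ˢ f → does (compatible? v L w) ≡ true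
    compatible {v} {L} {w} (pv ∷ pL) pw = dec-true (compatible? v L w)
      ( All.tabulate (λ x∈ → R-⊆ sub _ (r _ (All.lookup all x∈)))
      , All.tabulate (λ x∈ → vis-⊆ sub _ _ (mv _ _ pw (All.lookup (pv ∷ pL) x∈)))
      , All.tabulate (λ x∈ → vis-⊆ sub _ _ (mv _ _ pv (All.lookup pL x∈))))
      where
      all : All (_∈ˢ f) (w ∷ v ∷ L)
      all = pw ∷ pv ∷ pL
      sub : among (w ∷ v ∷ L) ⊆ˢ f
      sub x p = All.lookup all (among-∈ p)

    -- A vertex of `f` passes the test by monotonicity, so pruning discards none that count.
    filter-compatible : ∀ {v L} → All (_∈ˢ f) (v ∷ L) → ∀ ws →
      filterᵇ f (filterᵇ (does ∘ compatible? v L) ws) ≡ filterᵇ f ws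
    filter-compatible {v} {L} p []       = refl
    filter-compatible {v} {L} p (w ∷ ws) with f w in eq
    ... | true rewrite compatible p eq | eq = cong (w ∷_) (filter-compatible p ws)
    ... | false with does (compatible? v L w)
    ...   | false = filter-compatible p ws
    ...   | true rewrite eq = filter-compatible p ws

    length-true : ∀ {v} ws → f v ≡ true → length (filterᵇ f (v ∷ ws)) ≡ suc (length (filterᵇ f ws))
    length-true ws e rewrite e = refl

    length-false : ∀ {v} ws → f v ≡ false → length (filterᵇ f (v ∷ ws)) ≡ length (filterᵇ f ws)
    length-false ws e rewrite e = refl

    length-filterᵇ : ∀ ws → length (filterᵇ f ws) ≤ length ws
    length-filterᵇ []       = z≤n
    length-filterᵇ (w ∷ ws) with f w
    ... | true  = s≤s (length-filterᵇ ws)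
    ... | false = m≤n⇒m≤1+n (length-filterᵇ ws)

    search-sound : ∀ k {L} → All (_∈ˢ f) L → ∀ ws → search k L ws ≡ true → length (filterᵇ f ws) < k
    search-sound (suc k) p []       s = s≤s z≤n
    search-sound (suc k) p (v ∷ ws) s =
      [ (λ l → s≤s (≤-trans (length-filterᵇ (v ∷ ws)) l))
      , (λ (s₁ , s₂) →
          [ (λ e → subst (_< suc k) (sym (length-true ws e))
                     (s≤s (subst (_< k) (cong length (filter-compatible (e ∷ p) ws))
                       (search-sound k (e ∷ p) _ s₁))))
          , (λ e → subst (_< suc k) (sym (length-false ws e)) (search-sound (suc k) p ws s₂))
          ]′ (true⊎false (f v)))
      ]′ (search-step ws s)

    search-bound : ∀ N → search (suc N) [] (vertices m) ≡ true → count f ≤ N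
    search-bound N s = ≤-pred (subst (_< suc N) (sym (count-vertices f)) (search-sound (suc N) [] (vertices m) s))

-- Shortest walks

constant-corner : ∀ {m} c (t : SVertex m) → (∀ x → Vec.lookup t x ≡ c) → t ≡ corner m c
constant-corner c []      p = refl
constant-corner c (i ∷ t) p = cong₂ _∷_ (p zero) (constant-corner c t (p ∘ suc))

adj-copy : ∀ {m i} {t s : SVertex m} → SAdj m t s → SAdj (suc m) (i ∷ t) (i ∷ s)
adj-copy (h , below , at , above) =
  suc h , (λ { zero _ → refl ; (suc x) (s≤s l) → below x l }) , at , λ { (suc x) (s≤s l) → above x l }

adj-bridge : ∀ {m i j} → i ≢ j → SAdj (suc m) (i ∷ corner m j) (j ∷ corner m i)
adj-bridge n = zero , (λ _ ()) , n , λ { (suc x) _ → Vec.lookup-replicate x _ , Vec.lookup-replicate x _ }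

-- The index `h` of an edge is `zero` exactly for the edges between two copies, and these join
-- `i j…j` to `j i…i`.
data AdjView {m} : SVertex (suc m) → SVertex (suc m) → Set where
  inside : ∀ {i t s} → SAdj m t s → AdjView (i ∷ t) (i ∷ s)
  bridge : ∀ {i j} → i ≢ j → AdjView (i ∷ corner m j) (j ∷ corner m i)

adj-view : ∀ {m} u v → SAdj (suc m) u v → AdjView u v
adj-view (i ∷ t) (j ∷ s) (zero , below , at , above)
  with refl ← constant-corner j t (λ x → proj₁ (above (suc x) (s≤s z≤n)))
  with refl ← constant-corner i s (λ x → proj₂ (above (suc x) (s≤s z≤n))) = bridge at
adj-view (i ∷ t) (j ∷ s) (suc h , below , at , above)
  with refl ← below zero (s≤s z≤n) =
  inside (h , (λ x l → below (suc x) (s≤s l)) , at , λ x l → above (suc x) (s≤s l))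

adj-sym : ∀ {m} {u v : SVertex m} → SAdj m u v → SAdj m v u
adj-sym (h , below , at , above) =
  h , (λ x l → sym (below x l)) , at ∘ sym , λ x l → proj₂ (above x l) , proj₁ (above x l)

-- the length of a side, 2 ^ m ∸ 1
full : ℕ → ℕ
full zero    = 0
full (suc m) = full m + suc (full m)

suc-full : ∀ m → suc (full m) ≡ 2 ^ m
suc-full zero    = refl
suc-full (suc m) = trans (cong₂ _+_ (suc-full m) (suc-full m)) (sym (2^-split m))

dist-corner : ∀ m c → dist c (corner m c) ≡ 0
dist-corner zero    c = refl
dist-corner (suc m) c = trans (dist-same c (corner m c)) (dist-corner m c)

dist-other : ∀ m {c i} → i ≢ c → dist c (corner m i) ≡ full m
dist-other zero    n = refl
dist-other (suc m) n = trans (dist-diff n (corner m _))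
  (trans (cong₂ _+_ (sym (suc-full m)) (dist-other m n)) (+-comm (suc (full m)) (full m)))

-- A walk of length `n` with all vertices, ends included, outside `f`.
data Reach {m} (f : VSet m) : SVertex m → SVertex m → ℕ → Set where
  stop : ∀ {u} → f u ≡ false → Reach f u u 0
  step : ∀ {u w v n} → f u ≡ false → SAdj m u w → Reach f w v n → Reach f u v (suc n)

reach-copy : ∀ {m i} {f : VSet (suc m)} {t s n} → Reach (copy i f) t s n → Reach f (i ∷ t) (i ∷ s) n
reach-copy (stop p)     = stop p
reach-copy (step p a r) = step p (adj-copy a) (reach-copy r)

join : ∀ {m} {f : VSet m} {u v w x n k} →
  Reach f u v n → SAdj m v w → Reach f w x k → Reach f u x (n + suc k)
join (stop p)     b r = step p b r
join (step p a q) b r = step p a (join q b r)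

reach-snoc : ∀ {m} {f : VSet m} {u v w n} →
  Reach f u v n → SAdj m v w → f w ≡ false → Reach f u w (suc n)
reach-snoc (stop p)     a q = step p a (stop q)
reach-snoc (step p b r) a q = step p b (reach-snoc r a q)

reach-reverse : ∀ {m} {f : VSet m} {u v n} → Reach f u v n → Reach f v u n
reach-reverse (stop p)     = stop p
reach-reverse (step {u} {w} p a r) = reach-snoc (reach-reverse r) (adj-sym {u = u} {w} a) p

reach-side : ∀ {m} {f : VSet m} {a b} → a ≢ b → Side f a b → Reach f (corner m a) (corner m b) (full m)
reach-side {zero}  n p       = stop p
reach-side {suc m} n (p , q) = join (reach-copy (reach-side n p)) (adj-bridge n) (reach-copy (reach-side n q))

reach-sees : ∀ {m} {f : VSet m} {c} t → Sees f c t → f t ≡ false → Reach f t (corner m c) (dist c t)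
reach-sees [] p q = stop q
reach-sees {suc m} {f} {c} (i ∷ t) (p , s) q with i ≟ c
... | yes refl = reach-copy (reach-sees t p q)
... | no n = subst (Reach f _ _) (trans (cong (dist c t +_) (suc-full m)) (+-comm (dist c t) (2 ^ m)))
               (join (reach-copy (reach-sees t p q)) (adj-bridge n) (reach-copy (reach-side n (s n))))

-- Candidate paths with their lengths, not yet known to be shortest; as in `Sees`, the ends may lie
-- in `f`. The lengths include the edges between copies: one for `direct`, and for `via` two besides
-- a side of length `2 ^ m ∸ 1`.
data Geo : ∀ {m} → VSet m → SVertex m → SVertex m → ℕ → Set where
  empty  : ∀ {f} → Geo f [] [] 0
  same   : ∀ {m i n} {f : VSet (suc m)} {t s} → Geo (copy i f) t s n → Geo f (i ∷ t) (i ∷ s) n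
  direct : ∀ {m i j k n} {f : VSet (suc m)} {t s} → Perm i j k →
           Sees (copy i f) j t → Sees (copy j f) i s →
           n ≡ dist j t + dist i s + 1 → Geo f (i ∷ t) (j ∷ s) n
  via    : ∀ {m i j k n} {f : VSet (suc m)} {t s} → Perm i j k →
           Sees (copy i f) k t → Sees (copy j f) k s → Side (copy k f) i j →
           n ≡ dist k t + dist k s + 2 ^ m + 1 → Geo f (i ∷ t) (j ∷ s) n

geo-reach : ∀ {m} {f : VSet m} {u v n} → f u ≡ false → f v ≡ false → Geo f u v n → Reach f u v n
geo-reach p q empty    = stop p
geo-reach p q (same g) = reach-copy (geo-reach p q g)
geo-reach p q (direct {j = j} {t = t} {s} π a b refl) =
  subst (Reach _ _ _) (trans (+-suc _ _) (sym (+-comm _ 1)))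
    (join (reach-copy (reach-sees t a p)) (adj-bridge (perm-≢ π))
          (reach-copy (reach-reverse (reach-sees s b q))))
geo-reach p q (via {m} {k = k} {t = t} {s} π a b c refl) =
  subst (Reach _ _ _) lengths
    (join (reach-copy (reach-sees t a p)) (adj-bridge (perm-≢ (swap₂₃ π)))
      (join (reach-copy (reach-side (perm-≢ π) c)) (adj-bridge (perm-≢ (swap₁₂ (rotate π))))
        (reach-copy (reach-reverse (reach-sees s b q)))))
  where
  arith : ∀ x y z → x + suc (z + suc y) ≡ x + y + suc z + 1
  arith = solve-∀
  lengths : dist k t + suc (full m + suc (dist k s)) ≡ dist k t + dist k s + 2 ^ m + 1
  lengths = trans (arith (dist k t) (dist k s) (full m)) (cong (λ z → dist k t + dist k s + z + 1) (suc-full m))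

∅ : ∀ {m} → VSet m
∅ _ = false

side-∅ : ∀ {m a b} → Side {m} ∅ a b
side-∅ {zero}  = refl
side-∅ {suc m} = side-∅ , side-∅

sees-∅ : ∀ {m c} (t : SVertex m) → Sees ∅ c t
sees-∅ []      = tt
sees-∅ (i ∷ t) = sees-∅ t , λ _ → side-∅

sees-corner : ∀ {m} {f : VSet m} c → Sees f c (corner m c)
sees-corner {zero}  c = tt
sees-corner {suc m} c = sees-corner c , λ n → ⊥-elim (n refl)

corner-side : ∀ {m} {f : VSet m} {i c} → i ≢ c →
  f (corner m i) ≡ false → Sees f c (corner m i) → Side f i c
corner-side {zero}  n p q       = p
corner-side {suc m} n p (q , s) = corner-side n p q , s n

-- Distances and shortest paths are handled one edge at a time: a walk that starts
-- with an edge u u′ either is not shortest or extends the canonical path from u′.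
sees-step : ∀ {m} {f : VSet m} {c} t t' → SAdj m t t' → f t' ≡ false → Sees f c t' →
  dist c t ≤ dist c t' ⊎ dist c t ≡ suc (dist c t') × Sees f c t
sees-step {suc m} {f} {c} t t' a p q with adj-view t t' a
... | inside {i} {x} {y} b = Sum.map (+-monoʳ-≤ e) (λ (r , z) → trans (cong (e +_) r) (+-suc e _) , z , proj₂ q)
                           (sees-step x y b p (proj₁ q))
  where e = if does (i ≟ c) then 0 else 2 ^ m
... | bridge {i} {j} n with j ≟ c
...   | yes refl = inj₂ (trans (dist-diff n (corner m c)) (trans (cong₂ _+_ (sym (suc-full m)) (dist-corner m c))
                     (trans (+-identityʳ _) (cong suc (sym (dist-other m n))))) ,
                   sees-corner c , λ _ → corner-side n p (proj₁ q))
...   | no n' with i ≟ c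
...     | yes refl = inj₁ (subst (_≤ 2 ^ m + dist c (corner m c)) (sym (dist-other m n'))
                       (≤-trans (n≤1+n _) (≤-trans (≤-reflexive (suc-full m)) (m≤m+n _ _))))
...     | no n'' = inj₁ (+-monoʳ-≤ (2 ^ m) (≤-reflexive (trans (dist-other m n') (sym (dist-other m n'')))))

-- From a corner the direct route is the canonical path. A route via the third copy runs along two
-- whole sides before it reaches the copy of `s`, so it is strictly longer.
geo-corner : ∀ {m} {f : VSet m} {c s n} → f (corner m c) ≡ false → Geo f (corner m c) s n →
  dist c s < n ⊎ n ≡ dist c s × Sees f c s
geo-corner p empty = inj₂ (refl , tt)
geo-corner {c = c} p (same {s = s} g) rewrite dist-same c s =
  Sum.map₂ (λ (e , z) → e , z , λ n → ⊥-elim (n refl)) (geo-corner p g)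
geo-corner {suc m} {c = c} p (direct {j = j} {s = s} π a b refl) = inj₂ (eq , b , λ _ → side-sym (corner-side (perm-≢ π) p a))
  where
  arith : ∀ x y → x + y + 1 ≡ suc x + y
  arith = solve-∀
  eq : dist j (corner m c) + dist c s + 1 ≡ dist c (j ∷ s)
  eq rewrite dist-diff (perm-≢ (swap₁₂ π)) s | dist-other m (perm-≢ π) | sym (suc-full m) = arith (full m) (dist c s)
geo-corner {suc m} {c = c} p (via {j = j} {k} {s = s} π a b _ refl) = inj₁ lt
  where
  lt : dist c (j ∷ s) < dist k (corner m c) + dist k s + 2 ^ m + 1
  lt rewrite dist-diff (perm-≢ (swap₁₂ π)) s | dist-other m (perm-≢ (swap₂₃ π)) = begin-strict
    2 ^ m + dist c s             <⟨ +-monoʳ-< (2 ^ m) (dist-< c s) ⟩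
    2 ^ m + 2 ^ m                ≡⟨ cong (2 ^ m +_) (sym (suc-full m)) ⟩
    2 ^ m + suc (full m)         ≡⟨ arith (2 ^ m) (full m) ⟩
    full m + 2 ^ m + 1           ≤⟨ +-monoˡ-≤ 1 (+-monoˡ-≤ (2 ^ m) (m≤m+n (full m) (dist k s))) ⟩
    full m + dist k s + 2 ^ m + 1 ∎
    where
    open ≤-Reasoning
    arith : ∀ x y → x + suc y ≡ y + x + 1
    arith = solve-∀

geo-from-corner : ∀ {m} c (s : SVertex m) → Geo ∅ (corner m c) s (dist c s)
geo-from-corner c [] = empty
geo-from-corner {suc m} c (j ∷ s) with j ≟ c
... | yes refl = same (geo-from-corner c s)
... | no n = direct (third-perm (n ∘ sym)) (sees-∅ (corner m c)) (sees-∅ s) (sym eq)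
  where
  arith : ∀ x y → x + y + 1 ≡ suc x + y
  arith = solve-∀
  eq : dist j (corner m c) + dist c s + 1 ≡ 2 ^ m + dist c s
  eq rewrite dist-other m (n ∘ sym) | sym (suc-full m) = arith (full m) (dist c s)

-- The first alternative only serves to show that the walk is too long, so the path found there may
-- meet `f`; hence `∅`.
geo-step : ∀ {m} {f : VSet m} {u u' v n} → SAdj m u u' → f u' ≡ false → Geo f u' v n →
  (∃ λ k → k ≤ n × Geo ∅ u v k) ⊎ Geo f u v (suc n)
geo-step {suc m} {f} {u} {u'} a p g with adj-view u u' a
geo-step a p (same g)      | inside b =
  Sum.map (λ (k , l , h) → k , l , same h) same (geo-step b p g)
geo-step a p (direct {j = j} {t = y} {s} π q r refl) | inside {t = x} b =
  Sum.map (λ l → _ , +-monoˡ-≤ 1 (+-monoˡ-≤ _ l) , direct π (sees-∅ x) (sees-∅ s) refl)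
          (λ (e , z) → direct π z r (cong (λ d → d + _ + 1) (sym e)))
          (sees-step x y b p q)
geo-step {suc m} a p (via {j = j} {t = y} {s} π q r h refl) | inside {t = x} b =
  Sum.map (λ l → _ , +-monoˡ-≤ 1 (+-monoˡ-≤ (2 ^ m) (+-monoˡ-≤ _ l)) , via π (sees-∅ x) (sees-∅ s) side-∅ refl)
          (λ (e , z) → via π z r h (cong (λ d → d + _ + 2 ^ m + 1) (sym e)))
          (sees-step x y b p q)
geo-step {suc m} a p (same {s = s} g) | bridge {i} {j} n with geo-corner p g
... | inj₁ l = inj₁ (_ , ≤-trans (≤-reflexive (trans (cong (λ d → d + dist i s + 1) (dist-corner m j)) (+-comm _ 1))) l ,
                     direct (third-perm n) (sees-∅ (corner m j)) (sees-∅ s) refl)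
... | inj₂ (refl , z) = inj₂ (direct (third-perm n) (sees-corner j) z
                     (sym (trans (cong (λ d → d + dist i s + 1) (dist-corner m j)) (+-comm _ 1))))
geo-step {suc m} {f} a p (direct {j = j} {k} {s = s} π q r refl) | bridge {i} {l} n with i ≟ j
... | yes refl = inj₁ (dist l s , ≤-trans (m≤n+m (dist l s) _) (m≤m+n _ 1) , same (geo-from-corner l s))
-- The walk comes from the third copy, enters copy `l` at a corner and follows a side of it towards
-- `j`: this is the route via `l`.
... | no n' with refl ← perm-last π n n' =
  inj₂ (via (swap₁₂ (rotate π)) (sees-corner l) r (corner-side n' p q) eq)
  where
  arith : ∀ x y → suc (x + y + 1) ≡ y + suc x + 1
  arith = solve-∀
  eq : suc (dist j (corner m i) + dist l s + 1) ≡ dist l (corner m l) + dist l s + 2 ^ m + 1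
  eq rewrite dist-other m n' | dist-corner m l | sym (suc-full m) = arith (full m) (dist l s)
geo-step {suc m} a p (via {j = j} {k} {s = s} π q r h refl) | bridge {i} {l} n with i ≟ j
... | yes refl = inj₁ (dist l s ,
    ≤-trans (<⇒≤ (dist-< l s)) (≤-trans (m≤n+m (2 ^ m) _) (m≤m+n _ 1)) , same (geo-from-corner l s))
-- The walk leaves copy `i` and returns to it on the way to `j`, so the direct route is no longer.
... | no n' with refl ← perm-last π n n' =
  inj₁ (_ , le , direct (swap₁₂ (rotate π)) (sees-∅ (corner m l)) (sees-∅ s) refl)
  where
  le : dist j (corner m l) + dist i s + 1 ≤ dist i (corner m i) + dist i s + 2 ^ m + 1
  le rewrite dist-other m (perm-≢ π) | dist-corner m i | +-comm (dist i s) (2 ^ m) | sym (suc-full m) =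
    +-monoˡ-≤ 1 (+-monoˡ-≤ (dist i s) (n≤1+n (full m)))

geo-refl : ∀ {m} {f : VSet m} u → Geo f u u 0
geo-refl []      = empty
geo-refl (i ∷ t) = same (geo-refl t)

-- Edges are prepended to the candidate path found for the rest of the walk. Once the rest is known
-- to be too long, only lengths matter, and the induction goes on with `∅`.
walk-geo : ∀ {m} {f : VSet m} {u v} (P : Walk (SAdj m) u v) →
  (∀ w → w ∈ walkVertices P → f w ≡ false) →
  (∃ λ k → k < walkLength P × Geo ∅ u v k) ⊎ Geo f u v (walkLength P)
walk-geo {u = u} [] p = inj₂ (geo-refl u)
walk-geo {f = f} (a ∷ P) p with walk-geo {f = f} P (λ w → p w ∘ there)
... | inj₂ g = Sum.map₁ (λ (k , l , h) → k , s≤s l , h) (geo-step a (p _ (there (start P))) g)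
  where
  start : ∀ {V : Set} {Adj : V → V → Set} {u v} (P : Walk Adj u v) → u ∈ walkVertices P
  start []      = here refl
  start (_ ∷ _) = here refl
... | inj₁ (k , l , g) with geo-step a refl g
...   | inj₁ (k' , l' , h) = inj₁ (k' , s≤s (≤-trans l' (<⇒≤ l)) , h)
...   | inj₂ h = inj₁ (suc k , s≤s l , h)

reach-walk : ∀ {m} {f : VSet m} {u v n} → Reach f u v n →
  Σ (Walk (SAdj m) u v) λ P → walkLength P ≡ n × (∀ w → w ∈ walkVertices P → f w ≡ false)
reach-walk (stop p) = [] , refl , λ { w (here refl) → p }
reach-walk (step p a r) with P , e , q ← reach-walk r =
  a ∷ P , cong suc e , λ { w (here refl) → p ; w (there i) → q w i }

-- Agreement of `Vis` with `Visible`

Minimal : ∀ {m} → SVertex m → SVertex m → ℕ → Set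
Minimal u v n = ∀ k → Geo ∅ u v k → n ≤ k

geo-vis : ∀ {m} {f : VSet m} {u v n} → Geo f u v n → Minimal u v n → Vis f u v
geo-vis empty    l = tt
geo-vis (same g) l = (λ { refl → geo-vis g λ k h → l k (same h) }) , λ n → ⊥-elim (n refl)
geo-vis (direct {t = t} {s} π p q refl) l with refl ← perm-third π =
  (λ e → ⊥-elim (perm-≢ π e)) , λ n →
  inj₁ (+-cancelʳ-≤ 1 _ _ (l _ (via π (sees-∅ t) (sees-∅ s) side-∅ refl)) , p , q)
geo-vis (via {t = t} {s} π p q r refl) l with refl ← perm-third π =
  (λ e → ⊥-elim (perm-≢ π e)) , λ n →
  inj₂ (+-cancelʳ-≤ 1 _ _ (l _ (direct π (sees-∅ t) (sees-∅ s) refl)) , p , q , r)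

vis-geo : ∀ {m} {f : VSet m} u v → Vis f u v → ∃ λ n → Geo f u v n × Minimal u v n
vis-geo [] [] p = 0 , empty , λ _ _ → z≤n
vis-geo {suc m} (i ∷ t) (j ∷ s) (p , q) with i ≟ j
... | yes refl with n , g , l ← vis-geo t s (p refl) = n , same g , minimal
  where
  minimal : Minimal (i ∷ t) (i ∷ s) n
  minimal k (same h) = l k h
  minimal k (direct π _ _ _) = ⊥-elim (perm-≢ π refl)
  minimal k (via π _ _ _ _)  = ⊥-elim (perm-≢ π refl)
... | no n with q n
...   | inj₁ (l , a , b) = _ , direct (third-perm n) a b refl , minimal
  where
  minimal : Minimal (i ∷ t) (j ∷ s) (dist j t + dist i s + 1)
  minimal k (same _) = ⊥-elim (n refl)
  minimal k (direct _ _ _ refl) = ≤-refl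
  minimal k (via π _ _ _ refl) with refl ← perm-third π = +-monoˡ-≤ 1 l
...   | inj₂ (l , a , b , c) = _ , via (third-perm n) a b c refl , minimal
  where
  minimal : Minimal (i ∷ t) (j ∷ s) _
  minimal k (same _) = ⊥-elim (n refl)
  minimal k (direct _ _ _ refl) = +-monoˡ-≤ 1 l
  minimal k (via π _ _ _ refl) with refl ← perm-third π = ≤-refl

sees-start : ∀ {m} {f h : VSet m} {c} t → (∀ w → w ≢ t → w ∈ˢ f → w ∈ˢ h) → Sees h c t → Sees f c t
sees-start []      p q = tt
sees-start (i ∷ t) p (q , s) =
  sees-start t (λ w n → p (i ∷ w) (n ∘ Vec.∷-injectiveʳ)) q ,
  λ n → side-⊆ (λ w → p (_ ∷ w) (n ∘ sym ∘ Vec.∷-injectiveˡ)) (s n)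

-- `Sees` skips its start, and for `i ≢ j` each end lies in only one of the copies that a path
-- crosses, so no condition in `Vis` tests the ends.
vis-ends : ∀ {m} {f h : VSet m} u v → (∀ w → w ≢ u → w ≢ v → w ∈ˢ f → w ∈ˢ h) → Vis h u v → Vis f u v
vis-ends [] [] p q = tt
vis-ends {suc m} {f} {h} (i ∷ t) (j ∷ s) p (q , r) =
  (λ { refl → vis-ends t s (λ w a b → p (i ∷ w) (a ∘ Vec.∷-injectiveʳ) (b ∘ Vec.∷-injectiveʳ)) (q refl) }) ,
  λ n → cross n (third-perm n) (r n)
  where
  cross : ∀ {k} → i ≢ j → Perm i j k → Direct h i j k t s ⊎ Via h i j k t s → Direct f i j k t s ⊎ Via f i j k t s
  cross n π = Sum.map
    (λ (l , a , b) → l , sees-start t (λ w e → p (i ∷ w) (e ∘ Vec.∷-injectiveʳ) (n ∘ Vec.∷-injectiveˡ)) a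
                       , sees-start s (λ w e → p (j ∷ w) (n ∘ sym ∘ Vec.∷-injectiveˡ) (e ∘ Vec.∷-injectiveʳ)) b)
    (λ (l , a , b , c) → l , sees-start t (λ w e → p (i ∷ w) (e ∘ Vec.∷-injectiveʳ) (n ∘ Vec.∷-injectiveˡ)) a
                       , sees-start s (λ w e → p (j ∷ w) (n ∘ sym ∘ Vec.∷-injectiveˡ) (e ∘ Vec.∷-injectiveʳ)) b
                       , side-⊆ (λ w → p (_ ∷ w) (perm-≢ (swap₂₃ π) ∘ sym ∘ Vec.∷-injectiveˡ)
                                                 (perm-≢ (rotate π) ∘ sym ∘ Vec.∷-injectiveˡ)) c)

_∖_,_ : ∀ {m} → VSet m → SVertex m → SVertex m → VSet m
(f ∖ u , v) w = if does (w ≟ᵛ u) then false else if does (w ≟ᵛ v) then false else f w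

∖-intro : ∀ {m} {f : VSet m} {u v} w → w ≢ u → w ≢ v → w ∈ˢ f → w ∈ˢ (f ∖ u , v)
∖-intro {u = u} {v} w a b p with w ≟ᵛ u
... | yes e = ⊥-elim (a e)
... | no _ with w ≟ᵛ v
...   | yes e = ⊥-elim (b e)
...   | no _ = p

∖-elim : ∀ {m} {f : VSet m} {u v} w → (w ∈ˢ f → w ≡ u ⊎ w ≡ v) → (f ∖ u , v) w ≡ false
∖-elim {f = f} {u} {v} w p with w ≟ᵛ u
... | yes _ = refl
... | no a with w ≟ᵛ v
...   | yes _ = refl
...   | no b with f w
...     | false = refl
...     | true = ⊥-elim ([ a , b ]′ (p refl))

∖-⊆ : ∀ {m} {f : VSet m} {u v} → (f ∖ u , v) ⊆ˢ f
∖-⊆ {u = u} {v} w p with w ≟ᵛ u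
... | no _ with w ≟ᵛ v
...   | no _ = p

∖-false : ∀ {m} {f : VSet m} {u v} w → (f ∖ u , v) w ≡ false → w ∈ˢ f → w ≡ u ⊎ w ≡ v
∖-false {u = u} {v} w p q with w ≟ᵛ u
... | yes e = inj₁ e
... | no _ with w ≟ᵛ v
...   | yes e = inj₂ e
...   | no _ with () ← trans (sym q) p

-- The path of `Visible` may meet the set at its ends, whereas `walk-geo` wants it clear throughout;
-- so both ends are taken out of the set and put back by `vis-ends`.
visible⇒vis : ∀ {m} {X : List (SVertex m)} {u v} → Visible (SAdj m) X u v → Vis (among X) u v
visible⇒vis {m} {X} {u} {v} (P , shortest , avoid) =
  [ (λ (k , l , g) → ⊥-elim (<⇒≱ l (shorter g)))
  , (λ g → vis-ends u v (λ w a b → ∖-intro {f = among X} w a b) (geo-vis g λ k → shorter))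
  ]′ (walk-geo P λ w i → ∖-elim {f = among X} w (avoid w i ∘ among-∈))
  where
  shorter : ∀ {k} → Geo ∅ u v k → walkLength P ≤ k
  shorter g with Q , e , _ ← reach-walk (geo-reach refl refl g) = subst (walkLength P ≤_) e (shortest Q)

vis⇒visible : ∀ {m} {f : VSet m} {X : List (SVertex m)} {u v} → (∀ w → w ∈ X → w ∈ˢ f) →
  Vis f u v → Visible (SAdj m) X u v
vis⇒visible {m} {f} {X} {u} {v} sub p
  with n , g , l ← vis-geo u v (vis-⊆ (∖-⊆ {u = u} {v}) u v p)
  with P , e , a ← reach-walk (geo-reach (∖-elim {f = f} u λ _ → inj₁ refl) (∖-elim {f = f} v λ _ → inj₂ refl) g) =
  P , shortest , λ w i x → ∖-false {f = f} w (a w i) (sub w x)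
  where
  shortest : IsShortest P
  shortest Q with walk-geo {f = ∅} Q (λ _ _ → refl)
  ... | inj₁ (k , k< , h) = subst (_≤ walkLength Q) (sym e) (≤-trans (l k h) (<⇒≤ k<))
  ... | inj₂ h = subst (_≤ walkLength Q) (sym e) (l _ h)

-- Bounds in S² and S³

-- `Side` turned into a condition on single members of `f`, as the search needs it: the word has a
-- letter other than `a` and `b`.
OffSide : ∀ {m} → Fin 3 → Fin 3 → SVertex m → Set
OffSide a b []      = ⊥
OffSide a b (i ∷ t) = (i ≡ a → OffSide a b t) × (i ≡ b → OffSide a b t)

offSide? : ∀ {m} a b (v : SVertex m) → Dec (OffSide a b v)
offSide? a b []      = no λ ()
offSide? a b (i ∷ t) = ((i ≟ a) →-dec offSide? a b t) ×-dec ((i ≟ b) →-dec offSide? a b t)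

side-off : ∀ {m} {f : VSet m} {a b} → Side f a b → ∀ v → v ∈ˢ f → OffSide a b v
side-off p [] q with () ← trans (sym q) p
side-off (p , q) (i ∷ t) r = (λ { refl → side-off p t r }) , (λ { refl → side-off q t r })

data Req : Set where
  see    : Fin 3 → Req
  off    : Fin 3 → Fin 3 → Req
  closer : ℕ → Fin 3 → Fin 3 → Req
  _or_   : Req → Req → Req

⟦_⟧ : Req → ∀ {m} → VSet m → SVertex m → Set
⟦ see c        ⟧ f v = Sees f c v
⟦ off a b      ⟧ f v = OffSide a b v
⟦ closer d a b ⟧ f v = d + dist a v ≤ dist b v
⟦ r or s       ⟧ f v = ⟦ r ⟧ f v ⊎ ⟦ s ⟧ f v

⟦_⟧? : ∀ r {m} (f : VSet m) v → Dec (⟦ r ⟧ f v)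
⟦ see c        ⟧? f v = sees? f c v
⟦ off a b      ⟧? f v = offSide? a b v
⟦ closer d a b ⟧? f v = d + dist a v ≤? dist b v
⟦ r or s       ⟧? f v = ⟦ r ⟧? f v ⊎-dec ⟦ s ⟧? f v

req-⊆ : ∀ r {m} {f h : VSet m} → f ⊆ˢ h → ∀ v → ⟦ r ⟧ h v → ⟦ r ⟧ f v
req-⊆ (see c)        s v p = sees-⊆ s v p
req-⊆ (off a b)      s v p = p
req-⊆ (closer d a b) s v p = p
req-⊆ (q or r)       s v p = Sum.map (req-⊆ q s v) (req-⊆ r s v) p

Reqs : List Req → ∀ {m} → VSet m → SVertex m → Set
Reqs rs f v = All (λ r → ⟦ r ⟧ f v) rs

module Check (m : ℕ) (rs : List Req) =
  Search {m} (Reqs rs) (λ f v → All.all? (λ r → ⟦ r ⟧? f v) rs) (λ s v → All.map (λ {r} → req-⊆ r s v))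

record Exhausted (m : ℕ) (rs : List Req) (N : ℕ) : Set where
  constructor exhausted
  field
    none-left : Check.search m rs (suc N) [] (vertices m) ≡ true

bound : ∀ {m rs N} → Exhausted m rs N → (f : VSet m) → MV f → (∀ v → v ∈ˢ f → Reqs rs f v) → count f ≤ N
bound {m} {rs} {N} (exhausted e) f mv r = Check.search-bound m rs f mv r N e

exh-2 : Exhausted 2 [] 4
exh-2 = exhausted refl

exh-3 : Exhausted 3 [] 6
exh-3 = exhausted refl

exh-see : ∀ a → Exhausted 3 (see a ∷ []) 5
exh-see 0F = exhausted refl
exh-see 1F = exhausted refl
exh-see 2F = exhausted refl

exh-near : ∀ {a b c} → Perm a b c → Exhausted 3 (closer 1 a b ∷ see a ∷ []) 4
exh-near p012 = exhausted refl
exh-near p021 = exhausted refl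
exh-near p102 = exhausted refl
exh-near p120 = exhausted refl
exh-near p201 = exhausted refl
exh-near p210 = exhausted refl

exh-near-side : ∀ {a b c} → Perm a b c → Exhausted 3 (closer 1 a b ∷ off a b ∷ see a ∷ []) 3
exh-near-side p012 = exhausted refl
exh-near-side p021 = exhausted refl
exh-near-side p102 = exhausted refl
exh-near-side p120 = exhausted refl
exh-near-side p201 = exhausted refl
exh-near-side p210 = exhausted refl

exh-nearer-side : ∀ {a b c} → Perm a b c → Exhausted 3 (closer 2 a b ∷ off a b ∷ see a ∷ []) 2
exh-nearer-side p012 = exhausted refl
exh-nearer-side p021 = exhausted refl
exh-nearer-side p102 = exhausted refl
exh-nearer-side p120 = exhausted refl
exh-nearer-side p201 = exhausted refl
exh-nearer-side p210 = exhausted refl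

-- The distances come from `θ = 4` in S³: 5 is `suc θ`, and in the searches below 4 is `θ` and 7 is
-- `2 ^ 3 ∸ 1`. As g = 3, the bound 2 means `count f < g`.
exh-very-near : ∀ {a b c} → Perm a b c → Exhausted 3 (closer 5 a b ∷ see a ∷ []) 2
exh-very-near p012 = exhausted refl
exh-very-near p021 = exhausted refl
exh-very-near p102 = exhausted refl
exh-very-near p120 = exhausted refl
exh-very-near p201 = exhausted refl
exh-very-near p210 = exhausted refl

exh-see-or-near : ∀ {a b c} → Perm a b c → Exhausted 3 (see a ∷ (see b or closer 4 a b) ∷ []) 4
exh-see-or-near p012 = exhausted refl
exh-see-or-near p021 = exhausted refl
exh-see-or-near p102 = exhausted refl
exh-see-or-near p120 = exhausted refl
exh-see-or-near p201 = exhausted refl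
exh-see-or-near p210 = exhausted refl

exh-busy-or-near : ∀ {a b c} → Perm a b c →
  Exhausted 3 (off a b ∷ off a c ∷ see a ∷ see c ∷ (see b or closer 4 c b) ∷ []) 3
exh-busy-or-near p012 = exhausted refl
exh-busy-or-near p021 = exhausted refl
exh-busy-or-near p102 = exhausted refl
exh-busy-or-near p120 = exhausted refl
exh-busy-or-near p201 = exhausted refl
exh-busy-or-near p210 = exhausted refl

exh-extreme : ∀ {a b c} → Perm a b c →
  Exhausted 3 ((see b or closer 7 c b) ∷ (see c or closer 7 b c) ∷ []) 5
exh-extreme p012 = exhausted refl
exh-extreme p021 = exhausted refl
exh-extreme p102 = exhausted refl
exh-extreme p120 = exhausted refl
exh-extreme p201 = exhausted refl
exh-extreme p210 = exhausted refl

-- The bounds carried by the induction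

SeesAll : ∀ {m} → VSet m → Fin 3 → Set
SeesAll f c = ∀ v → v ∈ˢ f → Sees f c v

Nearer : ∀ {m} → ℕ → VSet m → Fin 3 → Fin 3 → Set
Nearer d f a b = ∀ v → v ∈ˢ f → d + dist a v ≤ dist b v

all-or-some : ∀ {m} {P : SVertex m → Set} → (∀ v → Dec (P v)) → (f : VSet m) →
  (∀ v → v ∈ˢ f → P v) ⊎ (∃ λ v → v ∈ˢ f × ¬ P v)
all-or-some {zero} P? f with P? []
... | yes p = inj₁ λ { [] _ → p }
... | no n with f [] in eq
...   | true  = inj₂ ([] , eq , n)
...   | false = inj₁ λ { [] e → ⊥-elim (case (trans (sym e) eq)) }
  where
  case : true ≢ false
  case ()
all-or-some {suc m} {P} P? f with go 0F | go 1F | go 2F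
  where
  go : ∀ i → _
  go i = all-or-some (λ t → P? (i ∷ t)) (copy i f)
... | inj₂ (t , p , n) | _ | _ = inj₂ (_ , p , n)
... | inj₁ _ | inj₂ (t , p , n) | _ = inj₂ (_ , p , n)
... | inj₁ _ | inj₁ _ | inj₂ (t , p , n) = inj₂ (_ , p , n)
... | inj₁ a | inj₁ b | inj₁ c = inj₁ λ { (0F ∷ t) → a t ; (1F ∷ t) → b t ; (2F ∷ t) → c t }

Inhabited : ∀ {m} → VSet m → Set
Inhabited f = ∃ λ v → v ∈ˢ f

count-empty : ∀ {m} {f : VSet m} → (∀ v → v ∈ˢ f → ⊥) → count f ≡ 0
count-empty {zero} {f} n with f [] in eq
... | true  = ⊥-elim (n [] eq)
... | false = refl
count-empty {suc m} n
  rewrite count-empty (λ t → n (0F ∷ t)) | count-empty (λ t → n (1F ∷ t)) | count-empty (λ t → n (2F ∷ t)) = refl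

inhabited-or-empty : ∀ {m} (f : VSet m) → Inhabited f ⊎ count f ≡ 0
inhabited-or-empty f with all-or-some {P = λ _ → ⊥} (λ _ → no λ ()) f
... | inj₁ n           = inj₂ (count-empty n)
... | inj₂ (v , p , _) = inj₁ (v , p)

count-perm : ∀ {m i j k} → Perm i j k → (f : VSet (suc m)) →
  count f ≡ count (copy i f) + (count (copy j f) + count (copy k f))
count-perm π f = lemma π (count (copy 0F f)) (count (copy 1F f)) (count (copy 2F f)) refl refl refl
  where
  a+[c+b] : ∀ a b c → a + (b + c) ≡ a + (c + b)
  a+[c+b] = solve-∀
  b+[a+c] : ∀ a b c → a + (b + c) ≡ b + (a + c)
  b+[a+c] = solve-∀
  b+[c+a] : ∀ a b c → a + (b + c) ≡ b + (c + a)
  b+[c+a] = solve-∀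
  c+[a+b] : ∀ a b c → a + (b + c) ≡ c + (a + b)
  c+[a+b] = solve-∀
  c+[b+a] : ∀ a b c → a + (b + c) ≡ c + (b + a)
  c+[b+a] = solve-∀
  lemma : ∀ {i j k} → Perm i j k → ∀ a b c → a ≡ count (copy 0F f) → b ≡ count (copy 1F f) → c ≡ count (copy 2F f) →
    a + (b + c) ≡ count (copy i f) + (count (copy j f) + count (copy k f))
  lemma p012 a b c refl refl refl = refl
  lemma p021 a b c refl refl refl = a+[c+b] a b c
  lemma p102 a b c refl refl refl = b+[a+c] a b c
  lemma p120 a b c refl refl refl = b+[c+a] a b c
  lemma p201 a b c refl refl refl = c+[a+b] a b c
  lemma p210 a b c refl refl refl = c+[b+a] a b c

-- In S³ the near bound is not yet below g, which the induction step needs; there the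
-- detours are controlled by these bounds instead. θ is half the side length.
record Fine (m g : ℕ) : Set where
  field
    θ            : ℕ
    θ+θ          : θ + θ ≡ 2 ^ m
    near-side    : ∀ {f : VSet m} {a b c} → Perm a b c → MV f →
                   SeesAll f a → Nearer 1 f a b → Side f a b → count f ≤ g
    near         : ∀ {f : VSet m} {a b c} → Perm a b c → MV f →
                   SeesAll f a → Nearer 1 f a b → count f ≤ 1 + g
    very-near    : ∀ {f : VSet m} {a b c} → Perm a b c → MV f →
                   SeesAll f a → Nearer (suc θ) f a b → count f < g
    nearer-side  : ∀ {f : VSet m} {a b c} → Perm a b c → MV f →
                   SeesAll f a → Nearer 2 f a b → Side f a b → count f < g
    see-or-near  : ∀ {f : VSet m} {a b c} → Perm a b c → MV f → SeesAll f a →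
                   (∀ v → v ∈ˢ f → Sees f b v ⊎ θ + dist a v ≤ dist b v) → count f ≤ 1 + g
    busy-or-near : ∀ {f : VSet m} {a b c} → Perm a b c → MV f → Side f a b → Side f a c →
                   SeesAll f a → SeesAll f c →
                   (∀ v → v ∈ˢ f → Sees f b v ⊎ θ + dist c v ≤ dist b v) → count f ≤ g
    extreme      : ∀ {f : VSet m} {a b c} → Perm a b c → MV f →
                   (∀ v → v ∈ˢ f → Sees f b v ⊎ 2 ^ m ∸ 1 + dist c v ≤ dist b v) →
                   (∀ v → v ∈ˢ f → Sees f c v ⊎ 2 ^ m ∸ 1 + dist b v ≤ dist c v) → count f ≤ 2 + g

-- Such a set misses copy `b`. From S⁴ on, where g = 3h with `3 ≤ h`, its other two copies hold at
-- most 2 + 2h < g.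
Coarse : (m g : ℕ) → Set
Coarse m g = ∀ {f : VSet m} {a b c} → Perm a b c → MV f → SeesAll f a → Nearer 1 f a b → count f < g

record Level (m g : ℕ) : Set where
  field
    mv-bound : ∀ {f : VSet m} → MV f → count f ≤ 3 + g
    see₁     : ∀ {f : VSet m} → MV f → ∀ {a} → SeesAll f a → count f ≤ 2 + g
    see₂     : ∀ {f : VSet m} {a b c} → Perm a b c → MV f → SeesAll f a → SeesAll f b → count f ≤ 1 + g
    busy     : ∀ {f : VSet m} {a b c} → Perm a b c → MV f → Side f a b → Side f a c →
               SeesAll f a → SeesAll f b → SeesAll f c → count f ≤ g
    mode     : Coarse m g ⊎ Fine m g

fine₃ : Fine 3 3
fine₃ = record
  { θ            = 4
  ; θ+θ          = refl
  ; near-side    = λ {f} {a} {b} {c} π mv s n d → bound (exh-near-side π) f mv λ v p → n v p ∷ side-off {3} {f} {a} {b} d v p ∷ s v p ∷ []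
  ; near         = λ {f} {a} {b} {c} π mv s n → bound (exh-near π) f mv λ v p → n v p ∷ s v p ∷ []
  ; very-near    = λ {f} {a} {b} {c} π mv s n → s≤s (bound (exh-very-near π) f mv λ v p → n v p ∷ s v p ∷ [])
  ; nearer-side  = λ {f} {a} {b} {c} π mv s n d → s≤s (bound (exh-nearer-side π) f mv λ v p → n v p ∷ side-off {3} {f} {a} {b} d v p ∷ s v p ∷ [])
  ; see-or-near  = λ {f} {a} {b} {c} π mv s n → bound (exh-see-or-near π) f mv λ v p → s v p ∷ n v p ∷ []
  ; busy-or-near = λ {f} {a} {b} {c} π mv d e s t n → bound (exh-busy-or-near π) f mv λ v p →
                     side-off {3} {f} {a} {b} d v p ∷ side-off {3} {f} {a} {c} e v p ∷ s v p ∷ t v p ∷ n v p ∷ []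
  ; extreme      = λ {f} {a} {b} {c} π mv r s → bound (exh-extreme π) f mv λ v p → r v p ∷ s v p ∷ []
  }

level₃ : Level 3 3
level₃ = record
  { mv-bound = λ {f} mv → bound exh-3 f mv λ _ _ → []
  ; see₁     = λ {f} mv {a} s → bound (exh-see a) f mv λ v p → s v p ∷ []
  ; see₂     = λ {f} {a} {b} {c} π mv s t → bound (exh-see-or-near π) f mv λ v p → s v p ∷ inj₁ (t v p) ∷ []
  ; busy     = λ {f} {a} {b} {c} π mv d e r s t → bound (exh-busy-or-near π) f mv λ v p →
                 side-off {3} {f} {a} {b} d v p ∷ side-off {3} {f} {a} {c} e v p ∷ r v p ∷ t v p ∷ inj₁ (s v p) ∷ []
  ; mode     = inj₂ fine₃
  }

-- The induction step

perm-from : ∀ a → ∃ λ b → ∃ λ c → Perm a b c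
perm-from 0F = 1F , 2F , p012
perm-from 1F = 0F , 2F , p102
perm-from 2F = 0F , 1F , p201

sum₃ : ∀ {a b c x y z N} → x + (y + z) ≡ N → a ≤ x → b ≤ y → c ≤ z → a + (b + c) ≤ N
sum₃ e p q r = ≤-trans (+-mono-≤ p (+-mono-≤ q r)) (≤-reflexive e)

sum₃< : ∀ {a b c x y z N} → x + (y + z) ≡ N → a ≤ x → b < y → c ≤ z → a + (b + c) < N
sum₃< e p q r = <-≤-trans (+-mono-≤-< p (+-mono-<-≤ q r)) (≤-reflexive e)

module Copies {m g} (level : Level m g) (f : VSet (suc m)) (mv : MV f) where

  open Level level

  F : Fin 3 → VSet m
  F i = copy i f

  mvᶜ : ∀ i → MV (F i)
  mvᶜ i t s p q = vis-same {f = f} (mv (i ∷ t) (i ∷ s) p q)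

  near≤ : ∀ {a b c i} → Perm a b c → SeesAll (F i) a → Nearer 1 (F i) a b → count (F i) ≤ 1 + g
  near≤ π s n with mode
  ... | inj₁ coarse = ≤-trans (<⇒≤ (coarse π (mvᶜ _) s n)) (n≤1+n g)
  ... | inj₂ fine   = Fine.near fine π (mvᶜ _) s n

  near-side≤ : ∀ {a b c i} → Perm a b c → SeesAll (F i) a → Nearer 1 (F i) a b → Side (F i) a b → count (F i) ≤ g
  near-side≤ π s n d with mode
  ... | inj₁ coarse = <⇒≤ (coarse π (mvᶜ _) s n)
  ... | inj₂ fine   = Fine.near-side fine π (mvᶜ _) s n d

  -- Such an x meets copy j only through the third copy.
  Detour : Fin 3 → Fin 3 → Set
  Detour i j = ∃ λ x → x ∈ˢ F i × ¬ Sees (F i) j x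

  sees-or-detour : ∀ i j → SeesAll (F i) j ⊎ Detour i j
  sees-or-detour i j = all-or-some (sees? (F i) j) (F i)

  must-detour : ∀ {i j k x y} → Perm i j k → x ∈ˢ F i → ¬ Sees (F i) j x → y ∈ˢ F j → Via f i j k x y
  must-detour {i} {j} {k} {x} {y} π p n q with vis-cross {f = f} π (mv (i ∷ x) (j ∷ y) p q)
  ... | inj₁ (_ , s , _) = ⊥-elim (n s)
  ... | inj₂ v = v

  -- Crossing copy `k` costs `2 ^ m`, and `x` alone saves less than that, as `dist j x < 2 ^ m`;
  -- hence `y` must save something too.
  via-near : ∀ {i j k x y} → Via f i j k x y → dist k y < dist i y
  via-near {i} {j} {k} {x} {y} (l , _) = +-cancelˡ-< (2 ^ m) _ _ (begin-strict
    2 ^ m + dist k y                ≡⟨ +-comm (2 ^ m) (dist k y) ⟩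
    dist k y + 2 ^ m                ≤⟨ +-monoˡ-≤ (2 ^ m) (m≤n+m (dist k y) (dist k x)) ⟩
    dist k x + dist k y + 2 ^ m     ≤⟨ l ⟩
    dist j x + dist i y             <⟨ +-monoˡ-< (dist i y) (dist-< j x) ⟩
    2 ^ m + dist i y                ∎)
    where open ≤-Reasoning

  via-near′ : ∀ {i j k x y} → Via f i j k x y → dist k x < dist j x
  via-near′ {i} {j} {k} {x} {y} (l , _) = +-cancelʳ-< (2 ^ m) _ _ (begin-strict
    dist k x + 2 ^ m                ≤⟨ +-monoˡ-≤ (2 ^ m) (m≤m+n (dist k x) (dist k y)) ⟩
    dist k x + dist k y + 2 ^ m     ≤⟨ l ⟩
    dist j x + dist i y             <⟨ +-monoʳ-< (dist j x) (dist-< i y) ⟩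
    dist j x + 2 ^ m                ∎)
    where open ≤-Reasoning

  detour-near : ∀ {i j k} → Perm i j k → Detour i j → Nearer 1 (F j) k i
  detour-near π (x , p , n) y q = via-near (must-detour π p n q)

  detour-sees : ∀ {i j k} → Perm i j k → Detour i j → SeesAll (F j) k
  detour-sees π (x , p , n) y q = proj₁ (proj₂ (proj₂ (must-detour π p n q)))

  detour-side : ∀ {i j k} → Perm i j k → Detour i j → Inhabited (F j) → Side (F k) i j
  detour-side π (x , p , n) (y , q) = proj₂ (proj₂ (proj₂ (must-detour π p n q)))

  not-nearer : ∀ {i a b} → Inhabited (F i) → Nearer 1 (F i) a b → Nearer 1 (F i) b a → ⊥
  not-nearer (y , q) r s = <-asym (r y q) (s y q)

  -- Detours into copy `j` from both other copies would place its vertices nearer to `k` than to `i`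
  -- and also nearer to `i` than to `k`.
  no-detour-kj : ∀ {i j k} → Perm i j k → Detour i j → Inhabited (F j) → ¬ Detour k j
  no-detour-kj π b ne c = not-nearer ne (detour-near π b) (detour-near (kji π) c)

  -- The detouring `x` is nearer to `k` than to `j`; a detour from `k` into copy `i` demands the
  -- opposite of it.
  no-detour-ki : ∀ {i j k} → Perm i j k → Detour i j → Inhabited (F j) → ¬ Detour k i
  no-detour-ki π (x , p , n) (y , q) c =
    <-asym (via-near′ (must-detour π p n q)) (detour-near (kij π) c x p)

  no-detour⇒sees : ∀ {i j} → ¬ Detour i j → SeesAll (F i) j
  no-detour⇒sees {i} {j} n with sees-or-detour i j
  ... | inj₁ s = s
  ... | inj₂ b = ⊥-elim (n b)

  -- x and y only meet through copy k, so a y that is not much nearer to k than to i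
  -- forces x to be much nearer to k than to j.
  sees-or-near : ∀ {i j k y} → Perm i j k → y ∈ˢ F j → ∀ d e → d + e ≡ 2 ^ m →
    dist i y ≤ e + dist k y → ∀ x → x ∈ˢ F i → Sees (F i) j x ⊎ d + dist k x ≤ dist j x
  sees-or-near {i} {j} {k} {y} π q d e d+e l x p with sees? (F i) j x
  ... | yes s = inj₁ s
  ... | no ¬s = inj₂ (+-cancelʳ-≤ (e + dist k y) _ _ (begin
      (d + dist k x) + (e + dist k y)     ≡⟨ arith d e (dist k x) (dist k y) ⟩
      dist k x + dist k y + (d + e)       ≡⟨ cong (dist k x + dist k y +_) d+e ⟩
      dist k x + dist k y + 2 ^ m         ≤⟨ proj₁ (must-detour π p ¬s q) ⟩
      dist j x + dist i y                 ≤⟨ +-monoʳ-≤ (dist j x) l ⟩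
      dist j x + (e + dist k y)           ∎))
    where
    open ≤-Reasoning
    arith : ∀ d e x y → (d + x) + (e + y) ≡ x + y + (d + e)
    arith = solve-∀

  -- A detour pays only if its two ends together save `2 ^ m`, which is split into halves: if some
  -- `y` saves at most `θ`, every detouring `x` saves at least `θ`; otherwise all of copy `j` saves
  -- more than `θ`, which leaves fewer than `g` vertices there.
  dichotomy : (fine : Fine m g) → ∀ {i j k} → Perm i j k → Detour i j →
    count (F j) < g ⊎ (∀ x → x ∈ˢ F i → Sees (F i) j x ⊎ Fine.θ fine + dist k x ≤ dist j x)
  dichotomy fine {i} {j} {k} π b
    with all-or-some (λ y → suc (Fine.θ fine) + dist k y ≤? dist i y) (F j)
  ... | inj₁ n           = inj₁ (Fine.very-near fine (kij π) (mvᶜ j) (detour-sees π b) n)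
  ... | inj₂ (y , q , n) = inj₂ (sees-or-near π q θ θ θ+θ (≮⇒≥ n))
    where
    open Fine fine

  -- Here the saving is split as `2 ^ m ∸ 1` and 1: with a side clear, a saving of 2 throughout copy
  -- `j` already brings it below `g`; otherwise `x` has to save `2 ^ m ∸ 1`.
  extreme-dichotomy : Fine m g → ∀ {i j k} → Perm i j k → Detour i j → Side (F j) k i →
    count (F j) < g ⊎ (∀ x → x ∈ˢ F i → Sees (F i) j x ⊎ 2 ^ m ∸ 1 + dist k x ≤ dist j x)
  extreme-dichotomy fine {i} {j} {k} π b d
    with all-or-some (λ y → 2 + dist k y ≤? dist i y) (F j)
  ... | inj₁ n           = inj₁ (Fine.nearer-side fine (kij π) (mvᶜ j) (detour-sees π b) n d)
  ... | inj₂ (y , q , n) = inj₂ (sees-or-near π q (2 ^ m ∸ 1) 1 (m∸n+n≡m (m^n>0 2 m)) (≤-pred (≰⇒> n)))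

  -- Both outcomes keep the pair within 2 + 2g, as without a detour. They are kept apart because
  -- `Balanced` needs either 1 + g in each copy or a strictly smaller total.
  detour-pair : ∀ {i j k} → Perm i j k → Detour i j → SeesAll (F i) k →
    count (F i) ≤ 1 + g × count (F j) ≤ 1 + g ⊎ count (F i) ≤ 2 + g × count (F j) < g
  detour-pair {i} {j} π b s with mode
  ... | inj₁ coarse = inj₂ (see₁ (mvᶜ i) s ,
                            coarse (kij π) (mvᶜ j) (detour-sees π b) (detour-near π b))
  ... | inj₂ fine with dichotomy fine π b
  ...   | inj₁ l = inj₂ (see₁ (mvᶜ i) s , l)
  ...   | inj₂ n = inj₁ (Fine.see-or-near fine (kji π) (mvᶜ i) s n ,
                         near≤ (kij π) (detour-sees π b) (detour-near π b))

  detour-busy-pair : ∀ {i j k} → Perm i j k → Detour i j → Side (F i) i j → Side (F i) i k →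
    SeesAll (F i) i → SeesAll (F i) k →
    count (F i) ≤ g × count (F j) ≤ 1 + g ⊎ count (F i) ≤ 1 + g × count (F j) < g
  detour-busy-pair {i} {j} π b d e s t with mode
  ... | inj₁ coarse = inj₂ (see₂ (swap₂₃ π) (mvᶜ i) s t ,
                            coarse (kij π) (mvᶜ j) (detour-sees π b) (detour-near π b))
  ... | inj₂ fine with dichotomy fine π b
  ...   | inj₁ l = inj₂ (see₂ (swap₂₃ π) (mvᶜ i) s t , l)
  ...   | inj₂ n = inj₁ (Fine.busy-or-near fine π (mvᶜ i) d e s t n ,
                         near≤ (kij π) (detour-sees π b) (detour-near π b))

  module _ {i j k} (π : Perm i j k) (b : Detour i j) (c : Detour i k)
    (nj : Inhabited (F j)) (nk : Inhabited (F k)) where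

    -- The detour from `i` to `k` crosses copy `j` and clears its side between `i` and `k`, which
    -- saves one more vertex.
    two-detours-j : count (F j) ≤ g
    two-detours-j = near-side≤ (kij π) (detour-sees π b) (detour-near π b)
                 (side-sym (detour-side (swap₂₃ π) c nk))

    two-detours-k : count (F k) ≤ g
    two-detours-k = near-side≤ (swap₁₂ π) (detour-sees (swap₂₃ π) c) (detour-near (swap₂₃ π) c)
                 (side-sym (detour-side π b nj))

    -- Copy `i` may now hold more than 1 + g vertices, so the total must be strictly smaller: either
    -- a target copy falls below `g`, or `extreme` saves one vertex in copy `i`.
    two-detours : count (F i) + (count (F j) + count (F k)) < 3 + (g + (g + g))
    two-detours with mode
    ... | inj₁ coarse = sum₃< (arith g) (mv-bound (mvᶜ i))
            (coarse (kij π) (mvᶜ j) (detour-sees π b) (detour-near π b)) two-detours-k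
      where
      arith : ∀ g → (3 + g) + (g + g) ≡ 3 + (g + (g + g))
      arith = solve-∀
    ... | inj₂ fine with extreme-dichotomy fine π b (side-sym (detour-side (swap₂₃ π) c nk))
                       | extreme-dichotomy fine (swap₂₃ π) c (side-sym (detour-side π b nj))
    ...   | inj₁ l | _ = sum₃< refl (mv-bound (mvᶜ i)) l two-detours-k
    ...   | inj₂ _ | inj₁ l = subst (λ z → count (F i) + z < 3 + (g + (g + g))) (+-comm (count (F k)) (count (F j)))
                                (sum₃< refl (mv-bound (mvᶜ i)) l two-detours-j)
    ...   | inj₂ p | inj₂ q = s≤s (sum₃ refl (Fine.extreme fine π (mvᶜ i) p q) two-detours-j two-detours-k)

  -- Without a detour both copies see a corner, giving 2 + g each. A detour frees one copy to hold 3
  -- + g but leaves at most 1 + g in the other.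
  pair-bound : ∀ {i j k} → Perm i j k → count (F i) + count (F j) ≤ 4 + (g + g)
  pair-bound {i} {j} π with inhabited-or-empty (F i) | inhabited-or-empty (F j)
  ... | inj₂ e | _ rewrite e = ≤-trans (mv-bound (mvᶜ j)) (+-mono-≤ (n≤1+n 3) (m≤m+n g g))
  ... | inj₁ _ | inj₂ e rewrite e | +-identityʳ (count (F i)) =
    ≤-trans (mv-bound (mvᶜ i)) (+-mono-≤ (n≤1+n 3) (m≤m+n g g))
  ... | inj₁ _ | inj₁ _ with sees-or-detour i j | sees-or-detour j i
  ...   | inj₁ s | inj₁ t = ≤-trans (+-mono-≤ (see₁ (mvᶜ i) s) (see₁ (mvᶜ j) t)) (≤-reflexive (arith g))
    where
    arith : ∀ g → (2 + g) + (2 + g) ≡ 4 + (g + g)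
    arith = solve-∀
  ...   | inj₂ b | _ =
    ≤-trans (+-mono-≤ (mv-bound (mvᶜ i)) (near≤ (kij π) (detour-sees π b) (detour-near π b))) (≤-reflexive (arith g))
    where
    arith : ∀ g → (3 + g) + (1 + g) ≡ 4 + (g + g)
    arith = solve-∀
  ...   | inj₁ _ | inj₂ b =
    ≤-trans (+-mono-≤ (near≤ (kij (swap₁₂ π)) (detour-sees (swap₁₂ π) b) (detour-near (swap₁₂ π) b)) (mv-bound (mvᶜ j)))
            (≤-reflexive (arith g))
    where
    arith : ∀ g → (1 + g) + (3 + g) ≡ 4 + (g + g)
    arith = solve-∀

  3g : ℕ
  3g = g + (g + g)

  skip-empty : ∀ {i j k} → Perm i j k → count (F k) ≡ 0 → count f ≡ count (F i) + count (F j)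
  skip-empty {i} {j} π e = trans (count-perm (kij π) f) (cong (_+ (count (F i) + count (F j))) e)

  assume-inhabited : ∀ {N} → (∀ {i j k} → Perm i j k → count (F i) + count (F j) ≤ N) →
    ((∀ i → Inhabited (F i)) → count f ≤ N) → count f ≤ N
  assume-inhabited two all
    with inhabited-or-empty (F 0F) | inhabited-or-empty (F 1F) | inhabited-or-empty (F 2F)
  ... | inj₁ a | inj₁ b | inj₁ c = all λ { 0F → a ; 1F → b ; 2F → c }
  ... | inj₂ e | _ | _ = ≤-trans (≤-reflexive (skip-empty p120 e)) (two p120)
  ... | inj₁ _ | inj₂ e | _ = ≤-trans (≤-reflexive (skip-empty p201 e)) (two p201)
  ... | inj₁ _ | inj₁ _ | inj₂ e = ≤-trans (≤-reflexive (skip-empty p012 e)) (two p012)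

  sees-copy : ∀ {c} → SeesAll f c → ∀ i → SeesAll (F i) c
  sees-copy s i t p = proj₁ (s (i ∷ t) p)

  -- The way from copy `i` to the corner `c…c` runs along the whole side of copy `c` between `i` and
  -- `c`.
  sees-side : ∀ {i c k} → Perm i c k → SeesAll f c → Inhabited (F i) → Side (F c) i c
  sees-side π s (t , p) = proj₂ (s (_ ∷ t) p) (perm-≢ π)

  module Total (ne : ∀ i → Inhabited (F i)) where

    -- One disjunction serves two claims: either alternative gives the bound 3 + 3g, and equality
    -- leaves only the first, which then forces 1 + g in each copy.
    Balanced : Set
    Balanced = (∀ i → count (F i) ≤ 1 + g) ⊎ count f < 3 + 3g

    perm< : ∀ {i j k N} → Perm i j k → count (F i) + (count (F j) + count (F k)) < N → count f < N
    perm< {N = N} π = subst (_< N) (sym (count-perm π f))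

    perm≤ : ∀ {i j k N} → Perm i j k → count (F i) + (count (F j) + count (F k)) ≤ N → count f ≤ N
    perm≤ {N = N} π = subst (_≤ N) (sym (count-perm π f))

    each : ∀ {i j k n} → Perm i j k → count (F i) ≤ n → count (F j) ≤ n → count (F k) ≤ n → ∀ l → count (F l) ≤ n
    each {i} {j} {k} π a b c l with l ≟ i | l ≟ j
    ... | yes refl | _ = a
    ... | no _ | yes refl = b
    ... | no p | no q with refl ← perm-last π p q = c

    balanced-detour : ∀ {i j k} → Perm i j k → Detour i j → Balanced
    balanced-detour {i} {j} {k} π b with sees-or-detour i k
    ... | inj₂ c = inj₂ (perm< π (two-detours π b c (ne j) (ne k)))
    ... | inj₁ s with detour-pair π b s
    ...   | inj₁ (p , q) = inj₁ (each π p q (see₂ π (mvᶜ k) (no-detour⇒sees (no-detour-ki π b (ne j))) (no-detour⇒sees (no-detour-kj π b (ne j)))))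
    ...   | inj₂ (p , q) = inj₂ (perm< π (sum₃< (arith g) p q
                             (see₂ π (mvᶜ k) (no-detour⇒sees (no-detour-ki π b (ne j))) (no-detour⇒sees (no-detour-kj π b (ne j))))))
      where
      arith : ∀ g → (2 + g) + (g + (1 + g)) ≡ 3 + (g + (g + g))
      arith = solve-∀

    balanced : Balanced
    balanced with sees-or-detour 0F 1F | sees-or-detour 0F 2F | sees-or-detour 1F 0F
                | sees-or-detour 1F 2F | sees-or-detour 2F 0F | sees-or-detour 2F 1F
    ... | inj₂ b | _ | _ | _ | _ | _ = balanced-detour p012 b
    ... | _ | inj₂ b | _ | _ | _ | _ = balanced-detour p021 b
    ... | _ | _ | inj₂ b | _ | _ | _ = balanced-detour p102 b
    ... | _ | _ | _ | inj₂ b | _ | _ = balanced-detour p120 b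
    ... | _ | _ | _ | _ | inj₂ b | _ = balanced-detour p201 b
    ... | _ | _ | _ | _ | _ | inj₂ b = balanced-detour p210 b
    ... | inj₁ s₀₁ | inj₁ s₀₂ | inj₁ s₁₀ | inj₁ s₁₂ | inj₁ s₂₀ | inj₁ s₂₁ =
      inj₁ λ { 0F → see₂ p120 (mvᶜ 0F) s₀₁ s₀₂ ; 1F → see₂ p021 (mvᶜ 1F) s₁₀ s₁₂ ; 2F → see₂ p012 (mvᶜ 2F) s₂₀ s₂₁ }

    module _ {a b c} (π : Perm a b c) (s : SeesAll f a) where

      side-ab : Side (F a) a b
      side-ab = side-sym (sees-side (swap₁₂ π) s (ne b))

      side-ac : Side (F a) a c
      side-ac = side-sym (sees-side (kij π) s (ne c))

    see₁-ab : ∀ {a b c} → Perm a b c → SeesAll f a → Detour a b → count f ≤ 2 + 3g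
    see₁-ab {a} {b} {c} π s det with sees-or-detour a c
    ... | inj₂ det′ = perm≤ π (sum₃ (arith g) (see₁ (mvᶜ a) (sees-copy s a)) (two-detours-j π det det′ (ne b) (ne c))
                                (two-detours-k π det det′ (ne b) (ne c)))
      where
      arith : ∀ g → (2 + g) + (g + g) ≡ 2 + (g + (g + g))
      arith = solve-∀
    ... | inj₁ t = [ (λ (p , q) → perm≤ π (sum₃ (arith g) p q third≤))
                   , (λ (p , q) → perm≤ π (<⇒≤ (sum₃< (arith′ g) p q third≤))) ]′
                   (detour-busy-pair π det (side-ab π s) (side-ac π s) (sees-copy s a) t)
      where
      third≤ : count (F c) ≤ 1 + g
      third≤ = see₂ π (mvᶜ c) (sees-copy s c) (no-detour⇒sees (no-detour-kj π det (ne b)))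
      arith : ∀ g → g + ((1 + g) + (1 + g)) ≡ 2 + (g + (g + g))
      arith = solve-∀
      arith′ : ∀ g → (1 + g) + (g + (1 + g)) ≡ 2 + (g + (g + g))
      arith′ = solve-∀

    -- The detour from `b` to `c` excludes detours from `a`, so copy `a` sees all three corners and
    -- `busy` applies to it.
    see₁-bc : ∀ {a b c} → Perm a b c → SeesAll f a → Detour b c → count f ≤ 2 + 3g
    see₁-bc {a} {b} {c} π s det =
      [ (λ (p , q) → perm≤ π (sum₃ (arith g) first≤ p q))
      , (λ (p , q) → perm≤ π (<⇒≤ (sum₃<′ p q))) ]′ (detour-pair (rotate π) det (sees-copy s b))
      where
      first≤ : count (F a) ≤ g
      first≤ = busy π (mvᶜ a) (side-ab π s) (side-ac π s) (sees-copy s a)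
                 (no-detour⇒sees (no-detour-ki (rotate π) det (ne c))) (no-detour⇒sees (no-detour-kj (rotate π) det (ne c)))
      arith : ∀ g → g + ((1 + g) + (1 + g)) ≡ 2 + (g + (g + g))
      arith = solve-∀
      arith′ : ∀ g → g + ((2 + g) + g) ≡ 2 + (g + (g + g))
      arith′ = solve-∀
      sum₃<′ : count (F b) ≤ 2 + g → count (F c) < g → count (F a) + (count (F b) + count (F c)) < 2 + 3g
      sum₃<′ p q = <-≤-trans (+-mono-≤-< first≤ (+-mono-≤-< p q)) (≤-reflexive (arith′ g))

    -- Detours towards `a` cannot occur, and exchanging `b` and `c` leaves two kinds. Without any,
    -- the traffic of the other copies to the corner clears two sides of copy `a`.
    see₁-total : ∀ {a b c} → Perm a b c → SeesAll f a → count f ≤ 2 + 3g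
    see₁-total {a} {b} {c} π s with sees-or-detour a b | sees-or-detour a c | sees-or-detour b c | sees-or-detour c b
    ... | inj₂ x | _ | _ | _ = see₁-ab π s x
    ... | _ | inj₂ x | _ | _ = see₁-ab (swap₂₃ π) s x
    ... | _ | _ | inj₂ x | _ = see₁-bc π s x
    ... | _ | _ | _ | inj₂ x = see₁-bc (swap₂₃ π) s x
    ... | inj₁ sab | inj₁ sac | inj₁ sbc | inj₁ scb = perm≤ π (sum₃ (arith g)
        (busy π (mvᶜ a) (side-ab π s) (side-ac π s) (sees-copy s a) sab sac)
        (see₂ (swap₂₃ π) (mvᶜ b) (sees-copy s b) sbc)
        (see₂ π (mvᶜ c) (sees-copy s c) scb))
      where
      arith : ∀ g → g + ((1 + g) + (1 + g)) ≡ 2 + (g + (g + g))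
      arith = solve-∀

    see₂-detour : ∀ {a b c} → Perm a b c → SeesAll f a → SeesAll f b → Detour a c → count f ≤ 1 + 3g
    see₂-detour {a} {b} {c} π s t det =
      [ (λ (p , q) → perm≤ (swap₂₃ π) (sum₃ (arith g) p q second≤))
      , (λ (p , q) → perm≤ (swap₂₃ π) (<⇒≤ (sum₃< (arith′ g) p q second≤))) ]′
      (detour-busy-pair (swap₂₃ π) det (side-ac π s) (side-ab π s) (sees-copy s a) (sees-copy t a))
      where
      second≤ : count (F b) ≤ g
      second≤ = busy (swap₁₂ π) (mvᶜ b) (side-ab (swap₁₂ π) t) (side-ac (swap₁₂ π) t) (sees-copy t b) (sees-copy s b)
                  (no-detour⇒sees (no-detour-kj (swap₂₃ π) det (ne c)))
      arith : ∀ g → g + ((1 + g) + g) ≡ 1 + (g + (g + g))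
      arith = solve-∀
      arith′ : ∀ g → (1 + g) + (g + g) ≡ 1 + (g + (g + g))
      arith′ = solve-∀

    -- Only copies `a` and `b` can detour, and only towards `c`; without a detour `busy` applies to
    -- both.
    see₂-total : ∀ {a b c} → Perm a b c → SeesAll f a → SeesAll f b → count f ≤ 1 + 3g
    see₂-total {a} {b} {c} π s t with sees-or-detour a c | sees-or-detour b c
    ... | inj₂ x | _ = see₂-detour π s t x
    ... | inj₁ _ | inj₂ x = see₂-detour (swap₁₂ π) t s x
    ... | inj₁ sac | inj₁ sbc = perm≤ (kij π) (sum₃ (arith g)
        (see₂ π (mvᶜ c) (sees-copy s c) (sees-copy t c))
        (busy π (mvᶜ a) (side-ab π s) (side-ac π s) (sees-copy s a) (sees-copy t a) sac)
        (busy (swap₁₂ π) (mvᶜ b) (side-ab (swap₁₂ π) t) (side-ac (swap₁₂ π) t) (sees-copy t b) (sees-copy s b) sbc))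
      where
      arith : ∀ g → (1 + g) + (g + g) ≡ 1 + (g + (g + g))
      arith = solve-∀

    -- Copy `b` inherits its side towards `a` from `f`, and its side towards `c` is cleared by the
    -- traffic of copy `c` to the corner `b…b`; likewise for copy `c`.
    busy-total : ∀ {a b c} → Perm a b c → Side f a b → Side f a c →
      SeesAll f a → SeesAll f b → SeesAll f c → count f ≤ 3g
    busy-total {a} {b} {c} π d e r s t = perm≤ π (sum₃ refl
      (busy π (mvᶜ a) (proj₁ d) (proj₁ e) (sees-copy r a) (sees-copy s a) (sees-copy t a))
      (busy (swap₁₂ π) (mvᶜ b) (side-sym (proj₂ d)) (side-ac (swap₁₂ π) s) (sees-copy s b) (sees-copy r b) (sees-copy t b))
      (busy (kij π) (mvᶜ c) (side-sym (proj₂ e)) (side-ac (kij π) t) (sees-copy t c) (sees-copy r c) (sees-copy s c)))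

  -- Every vertex of copy `b` is closer than `2 ^ m` to `b…b` and at least `2 ^ m` away from `a…a`.
  b-empty : ∀ {a b c} → Perm a b c → Nearer 1 f a b → count (F b) ≡ 0
  b-empty {a} {b} π n = count-empty λ t p → <⇒≱ (begin-strict
    dist b (b ∷ t)       ≡⟨ dist-same b t ⟩
    dist b t             <⟨ dist-< b t ⟩
    2 ^ m                ≤⟨ m≤m+n (2 ^ m) (dist a t) ⟩
    2 ^ m + dist a t     ≡⟨ sym (dist-diff (perm-≢ (swap₁₂ π)) t) ⟩
    dist a (b ∷ t)       ∎) (<⇒≤ (n (b ∷ t) p))
    where open ≤-Reasoning

  two-copies≤ : 3 ≤ g → 4 + (g + g) ≤ 2 + 3g
  two-copies≤ l = ≤-trans (≤-reflexive (arith g)) (+-monoʳ-≤ 2 (+-monoˡ-≤ (g + g) (≤-trans (n≤1+n 2) l)))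
    where
    arith : ∀ g → 4 + (g + g) ≡ 2 + (2 + (g + g))
    arith = solve-∀

  empty-copy : ∀ {i j k} → Perm i j k → 3 ≤ g → count (F k) ≡ 0 → count f ≤ 2 + 3g
  empty-copy π l e = ≤-trans (≤-reflexive (skip-empty π e)) (≤-trans (pair-bound π) (two-copies≤ l))

  balanced-or-small : 3 ≤ g → (∀ i → count (F i) ≤ 1 + g) ⊎ count f < 3 + 3g
  balanced-or-small l with inhabited-or-empty (F 0F) | inhabited-or-empty (F 1F) | inhabited-or-empty (F 2F)
  ... | inj₁ a | inj₁ b | inj₁ c = Total.balanced λ { 0F → a ; 1F → b ; 2F → c }
  ... | inj₂ e | _ | _ = inj₂ (s≤s (empty-copy p120 l e))
  ... | _ | inj₂ e | _ = inj₂ (s≤s (empty-copy p201 l e))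
  ... | _ | _ | inj₂ e = inj₂ (s≤s (empty-copy p012 l e))

  mv-total : 3 ≤ g → count f ≤ 3 + 3g
  mv-total l with balanced-or-small l
  ... | inj₂ p = <⇒≤ p
  ... | inj₁ e = ≤-trans (+-mono-≤ (e 0F) (+-mono-≤ (e 1F) (e 2F))) (≤-reflexive (arith g))
    where
    arith : ∀ g → (1 + g) + ((1 + g) + (1 + g)) ≡ 3 + (g + (g + g))
    arith = solve-∀

  see₁-bound : 3 ≤ g → ∀ {a} → SeesAll f a → count f ≤ 2 + 3g
  see₁-bound l {a} s = assume-inhabited (λ π → ≤-trans (pair-bound π) (two-copies≤ l)) λ ne → Total.see₁-total ne (proj₂ (proj₂ (perm-from a))) s

  two-small : (∀ i → count (F i) ≤ 1 + g) → ∀ i j → count (F i) + count (F j) ≤ 2 + (g + g)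
  two-small p i j = ≤-trans (+-mono-≤ (p i) (p j)) (≤-reflexive (arith g))
    where
    arith : ∀ g → (1 + g) + (1 + g) ≡ 2 + (g + g)
    arith = solve-∀

  see₂-bound : 3 ≤ g → ∀ {a b c} → Perm a b c → SeesAll f a → SeesAll f b → count f ≤ 1 + 3g
  see₂-bound l π s t =
    assume-inhabited (λ _ → ≤-trans (two-small (λ i → see₂ π (mvᶜ i) (sees-copy s i) (sees-copy t i)) _ _)
      (s≤s (+-monoˡ-≤ (g + g) (≤-trans (s≤s z≤n) l)))) λ ne → Total.see₂-total ne π s t

  busy-bound : 3 ≤ g → ∀ {a b c} → Perm a b c → Side f a b → Side f a c →
    SeesAll f a → SeesAll f b → SeesAll f c → count f ≤ 3g
  busy-bound l π d e r s t =
    assume-inhabited (λ _ → ≤-trans (two-small (λ i → see₂ π (mvᶜ i) (sees-copy r i) (sees-copy s i)) _ _)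
      (+-monoˡ-≤ (g + g) (≤-trans (n≤1+n 2) l))) λ ne → Total.busy-total ne π d e r s t

  coarse-bound : 3 ≤ g → ∀ {a b c} → Perm a b c → SeesAll f a → Nearer 1 f a b → count f < 3g
  coarse-bound l {a} {b} {c} π s n with inhabited-or-empty (F c)
  ... | inj₂ e = begin-strict
    count f                                     ≡⟨ count-perm π f ⟩
    count (F a) + (count (F b) + count (F c))   ≡⟨ cong₂ (λ x y → count (F a) + (x + y)) empty-b e ⟩
    count (F a) + 0                             ≡⟨ +-identityʳ _ ⟩
    count (F a)                                 ≤⟨ see₁ (mvᶜ a) (sees-copy s a) ⟩
    2 + g                                       <⟨ +-monoˡ-≤ g l ⟩
    g + g                                       ≤⟨ m≤n+m (g + g) g ⟩
    3g                                          ∎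
    where
    open ≤-Reasoning
    empty-b : count (F b) ≡ 0
    empty-b = b-empty π n
  ... | inj₁ (y , q) = begin-strict
    count f                                     ≡⟨ count-perm π f ⟩
    count (F a) + (count (F b) + count (F c))   ≡⟨ cong (λ x → count (F a) + (x + count (F c))) (b-empty π n) ⟩
    count (F a) + count (F c)                   ≤⟨ +-mono-≤ (see₂ (swap₂₃ π) (mvᶜ a) (sees-copy s a) seen)
                                                            (near≤ π (sees-copy s c) near-c) ⟩
    (1 + g) + (1 + g)                           ≡⟨ arith g ⟩
    2 + (g + g)                                 <⟨ +-monoˡ-≤ (g + g) l ⟩
    3g                                          ∎
    where
    open ≤-Reasoning
    arith : ∀ g → (1 + g) + (1 + g) ≡ 2 + (g + g)
    arith = solve-∀
    near-c : Nearer 1 (F c) a b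
    near-c t p = +-cancelˡ-< (2 ^ m) _ _
      (subst₂ _<_ (dist-diff (perm-≢ (kij π)) t) (dist-diff (perm-≢ (kji π)) t) (n (c ∷ t) p))
    -- A detour from `a` to `c` would place copy `c` nearer to `b` than to `a`, against `near-c`.
    seen : SeesAll (F a) c
    seen = no-detour⇒sees λ det → <-asym (near-c y q) (detour-near (swap₂₃ π) det y q)

level-suc : ∀ {m g} → 3 ≤ g → Level m g → Level (suc m) (g + (g + g))
level-suc l L = record
  { mv-bound = λ {f} mv → Copies.mv-total L f mv l
  ; see₁     = λ {f} mv {a} s → Copies.see₁-bound L f mv l {a} s
  ; see₂     = λ {f} π mv → Copies.see₂-bound L f mv l π
  ; busy     = λ {f} π mv → Copies.busy-bound L f mv l π
  -- Every level above S³ is coarse, so `Fine` serves only the step from S³ to S⁴.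
  ; mode     = inj₁ λ {f} π mv → Copies.coarse-bound L f mv l π
  }

-- Extremal sets

-- Each copy of the extremal set keeps one corner, and the copies of that copy keep one or none, so
-- the recursion has to run over all three kinds of set.
data Corners : Set where
  none : Corners
  one  : Fin 3 → Corners
  all  : Corners

restrict : Fin 3 → Corners → Corners
restrict i none    = none
restrict i (one c) = if does (c ≟ i) then one c else none
restrict i all     = one i

Absent : Fin 3 → Corners → Set
Absent c none    = ⊤
Absent c (one d) = d ≢ c
Absent c all     = ⊥

absent? : ∀ c C → Dec (Absent c C)
absent? c none    = yes tt
absent? c (one d) = ¬? (d ≟ c)
absent? c all     = no λ ()

absent-restrict : ∀ {c} i C → Absent c C → Absent c (restrict i C)
absent-restrict i none    p = tt
absent-restrict i (one d) p with d ≟ i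
... | yes _ = p
... | no _  = tt

absent-other : ∀ {c i} C → i ≢ c → Absent c (restrict i C)
absent-other none n = tt
absent-other {i = i} (one d) n with d ≟ i
... | yes refl = n
... | no _     = tt
absent-other all n = n

cyclic : Fin 3 → Fin 3 → Fin 3 → Bool
cyclic 0F 1F 2F = true
cyclic 1F 2F 0F = true
cyclic 2F 0F 1F = true
cyclic _  _  _  = false

witness : Corners → ∀ m → VSet (3 + m)
witness C zero    (a ∷ b ∷ c ∷ []) =
  cyclic a b c ∨ (does (a ≟ b) ∧ (does (b ≟ c) ∧ does (¬? (absent? a C))))
witness C (suc m) (i ∷ t)          = witness (restrict i C) m t

forall? : ∀ {m} {P : SVertex m → Set} → (∀ v → Dec (P v)) → Dec (∀ v → P v)
forall? P? with all-or-some P? (λ _ → true)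
... | inj₁ p           = yes λ v → p v refl
... | inj₂ (v , _ , n) = no λ p → n (p v)

_∈ˢ?_ : ∀ {m} (v : SVertex m) (f : VSet m) → Dec (v ∈ˢ f)
v ∈ˢ? f = f v Bool.≟ true

mv? : ∀ {m} (f : VSet m) → Dec (MV f)
mv? f = forall? λ u → forall? λ v → (u ∈ˢ? f) →-dec ((v ∈ˢ? f) →-dec vis? f u v)

witness-side₀ : ∀ a b C → Absent a C → Absent b C → Side (witness C 0) a b
witness-side₀ a b none    = from-yes (all? λ a → all? λ b → P? a b) a b
  where P? = λ a b → absent? a none →-dec (absent? b none →-dec side? (witness none 0) a b)
witness-side₀ a b (one c) = from-yes (all? λ a → all? λ b → all? λ c → P? a b c) a b c
  where P? = λ a b c → absent? a (one c) →-dec (absent? b (one c) →-dec side? (witness (one c) 0) a b)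

witness-sees₀ : ∀ a C → Absent a C → SeesAll (witness C 0) a
witness-sees₀ a none    = from-yes (all? P?) a
  where P? = λ a → absent? a none →-dec forall? λ v → (v ∈ˢ? witness none 0) →-dec sees? (witness none 0) a v
witness-sees₀ a (one c) = from-yes (all? λ a → all? λ c → P? a c) a c
  where P? = λ a c → absent? a (one c) →-dec
                forall? λ v → (v ∈ˢ? witness (one c) 0) →-dec sees? (witness (one c) 0) a v

witness-mv₀ : ∀ C → MV (witness C 0)
witness-mv₀ none    = from-yes (mv? (witness none 0))
witness-mv₀ (one c) = from-yes (all? λ c → mv? (witness (one c) 0)) c
witness-mv₀ all     = from-yes (mv? (witness all 0))

-- A word ending in 012, 120 or 201 uses all three letters, so only retained corners could lie on a
-- side.
witness-side : ∀ m {a b} C → Absent a C → Absent b C → Side (witness C m) a b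
witness-side zero    C p q = witness-side₀ _ _ C p q
witness-side (suc m) C p q =
  witness-side m (restrict _ C) (absent-restrict _ C p) (absent-restrict _ C q) ,
  witness-side m (restrict _ C) (absent-restrict _ C p) (absent-restrict _ C q)

witness-sees : ∀ m {a} C → Absent a C → SeesAll (witness C m) a
witness-sees zero    C p v       q = witness-sees₀ _ C p v q
witness-sees (suc m) C p (i ∷ t) q =
  witness-sees m (restrict i C) (absent-restrict i C p) t q ,
  λ n → witness-side m (restrict _ C) (absent-other C (n ∘ sym)) (absent-restrict _ C p)

witness-mv : ∀ m C → MV (witness C m)
witness-mv zero    C = witness-mv₀ C
witness-mv (suc m) C (i ∷ t) (j ∷ s) p q =
  (λ { refl → witness-mv m (restrict i C) t s p q }) , λ n → cross (third-perm n)
  where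
  f = witness C (suc m)
  cross : ∀ {k} → Perm i j k → Direct f i j k t s ⊎ Via f i j k t s
  -- A copy retains no corner other than its own, so both paths are unobstructed and the shorter one
  -- serves.
  cross {k} π with ≤-total (dist j t + dist i s) (dist k t + dist k s + 2 ^ (3 + m))
  ... | inj₁ l = inj₁ (l , witness-sees m (restrict i C) (absent-other C (perm-≢ π)) t p
                         , witness-sees m (restrict j C) (absent-other C (perm-≢ (swap₁₂ π))) s q)
  ... | inj₂ l = inj₂ (l , witness-sees m (restrict i C) (absent-other C (perm-≢ (swap₂₃ π))) t p
                         , witness-sees m (restrict j C) (absent-other C (perm-≢ (rotate π))) s q
                         , witness-side m (restrict k C) (absent-other C (perm-≢ (kij π)))
                                                         (absent-other C (perm-≢ (kji π))))

tripled : ∀ x → x + (x + x) ≡ 3 * x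
tripled = solve-∀

count-none : ∀ m → count (witness none m) ≡ 3 ^ (1 + m)
count-none zero    = refl
count-none (suc m) rewrite count-none m = tripled (3 ^ (1 + m))

count-one : ∀ m c → count (witness (one c) m) ≡ 1 + 3 ^ (1 + m)
count-one zero    0F = refl
count-one zero    1F = refl
count-one zero    2F = refl
count-one (suc m) 0F rewrite count-one m 0F | count-none m = cong suc (tripled (3 ^ (1 + m)))
count-one (suc m) 1F rewrite count-one m 1F | count-none m =
  trans (+-suc (3 ^ (1 + m)) _) (cong suc (tripled (3 ^ (1 + m))))
count-one (suc m) 2F rewrite count-one m 2F | count-none m =
  trans (arith (3 ^ (1 + m))) (cong suc (tripled (3 ^ (1 + m))))
  where
  arith : ∀ x → x + (x + suc x) ≡ suc (x + (x + x))
  arith = solve-∀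

count-all : ∀ m → count (witness all m) ≡ 3 ^ (1 + m) + 3
count-all zero = refl
count-all (suc m) rewrite count-one m 0F | count-one m 1F | count-one m 2F = arith (3 ^ (1 + m))
  where
  arith : ∀ x → suc x + (suc x + suc x) ≡ 3 * x + 3
  arith = solve-∀

-- In S² the words are too short for the endings used above; these four vertices attain 3 ^ 0 + 3.
witness₂ : VSet 2
witness₂ (0F ∷ 0F ∷ []) = true
witness₂ (0F ∷ 1F ∷ []) = true
witness₂ (2F ∷ 1F ∷ []) = true
witness₂ (2F ∷ 2F ∷ []) = true
witness₂ _              = false

-- Lists and counts

count-ext : ∀ {m} {f h : VSet m} → (∀ v → f v ≡ h v) → count f ≡ count h
count-ext {zero}  e rewrite e [] = refl
count-ext {suc m} e = cong₂ _+_ (count-ext (e ∘ (0F ∷_)))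
  (cong₂ _+_ (count-ext (e ∘ (1F ∷_))) (count-ext (e ∘ (2F ∷_))))

count-insert : ∀ {m} {f h : VSet m} x → f x ≡ false → (∀ v → h v ≡ does (v ≟ᵛ x) ∨ f v) →
  count h ≡ suc (count f)
count-insert {zero} [] p e rewrite e [] | p = refl
count-insert {suc m} {f} (0F ∷ x) p e = cong₂ _+_ (count-insert x p (e ∘ (0F ∷_)))
  (cong₂ _+_ (count-ext (e ∘ (1F ∷_))) (count-ext (e ∘ (2F ∷_))))
count-insert {suc m} {f} (1F ∷ x) p e = trans
  (cong₂ _+_ (count-ext (e ∘ (0F ∷_)))
    (cong₂ _+_ (count-insert x p (e ∘ (1F ∷_))) (count-ext (e ∘ (2F ∷_)))))
  (+-suc (count (copy 0F f)) _)
count-insert {suc m} {f} (2F ∷ x) p e = trans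
  (cong₂ _+_ (count-ext (e ∘ (0F ∷_)))
    (trans (cong₂ _+_ (count-ext (e ∘ (1F ∷_))) (count-insert x p (e ∘ (2F ∷_)))) (+-suc (count (copy 1F f)) _)))
  (+-suc (count (copy 0F f)) _)

count-∅ : ∀ m → count {m} ∅ ≡ 0
count-∅ m = count-empty {m} {∅} λ _ ()

length-count : ∀ {m} {X : List (SVertex m)} → Unique X → length X ≡ count (among X)
length-count {m} AllPairs.[] = sym (count-∅ m)
length-count {X = x ∷ X} (d AllPairs.∷ u) = trans (cong suc (length-count u))
  (sym (count-insert x (dec-false (any? (x ≟ᵛ_) X) (λ i → All.lookup d i refl)) λ _ → refl))

vertices-unique : ∀ m → Unique (vertices m)
vertices-unique zero    = [] AllPairs.∷ AllPairs.[]
vertices-unique (suc m) =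
  Unique.++⁺ (part 0F) (Unique.++⁺ (part 1F) (part 2F) (λ (p , q) → apart (λ ()) p q))
    λ (p , q) → [ apart (λ ()) p , apart (λ ()) p ]′ (∈-++⁻ (map (1F ∷_) (vertices m)) q)
  where
  part : ∀ i → Unique (map (i ∷_) (vertices m))
  part i = Unique.map⁺ Vec.∷-injectiveʳ (vertices-unique m)
  apart : ∀ {i j v} → i ≢ j → v ∈ map (i ∷_) (vertices m) → v ∈ map (j ∷_) (vertices m) → ⊥
  apart n p q with _ , _ , refl ← ∈-map⁻ _ p | _ , _ , refl ← ∈-map⁻ _ q = n refl

mv-among : ∀ {m} {X : List (SVertex m)} → IsMutualVisibilitySet (SAdj m) X → MV (among X)
mv-among M u v p q = visible⇒vis (M u v (among-∈ p) (among-∈ q))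

isMu : ∀ {m k} (f : VSet m) → MV f → count f ≡ k → (∀ {h : VSet m} → MV h → count h ≤ k) → IsMu (SAdj m) k
isMu {m} {k} f mv e b =
  (X , Unique.filter⁺ (Bool.T? ∘ f) (vertices-unique m)
     , (λ u v p q → vis⇒visible {f = f} (λ w → in-f) (mv u v (in-f p) (in-f q)))
     , trans (sym (count-vertices f)) e) ,
  λ Y uY MY → subst (_≤ k) (sym (length-count uY)) (b (mv-among MY))
  where
  X = filterᵇ f (vertices m)
  in-f : ∀ {w} → w ∈ X → w ∈ˢ f
  in-f p = Bool.T-≡ .Equivalence.to (proj₂ (∈-filter⁻ (Bool.T? ∘ f) {xs = vertices m} p))

level : ∀ k → Level (3 + k) (3 ^ (1 + k))
level zero    = level₃
level (suc k) = subst (Level (4 + k)) (tripled (3 ^ (1 + k))) (level-suc (m≤m*n 3 (3 ^ k) ⦃ m^n≢0 3 k ⦄) (level k))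

among-filter : ∀ {m} {P : SVertex m → Set} (P? : Decidable P) (X : List (SVertex m)) v →
  among (filter P? X) v ≡ does (P? v) ∧ among X v
among-filter P? X v with P? v
... | no ¬p = dec-false (any? (v ≟ᵛ_) (filter P? X)) (¬p ∘ proj₂ ∘ ∈-filter⁻ P? {xs = X})
... | yes p with any? (v ≟ᵛ_) X
...   | yes q = dec-true (any? (v ≟ᵛ_) (filter P? X)) (∈-filter⁺ P? q p)
...   | no ¬q = dec-false (any? (v ≟ᵛ_) (filter P? X)) (¬q ∘ proj₁ ∘ ∈-filter⁻ P? {xs = X})

countCopy-count : ∀ {m} {X : List (SVertex (suc m))} → Unique X → ∀ i →
  countCopy i X ≡ count (copy i (among X))
countCopy-count {m} {X} u i = begin
  countCopy i X                                    ≡⟨ length-count (Unique.filter⁺ (inCopy? i) u) ⟩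
  count (among (filter (inCopy? i) X))             ≡⟨ count-ext (among-filter (inCopy? i) X) ⟩
  count (λ v → does (inCopy? i v) ∧ among X v)     ≡⟨ only i (among X) ⟩
  count (copy i (among X))                         ∎
  where
  open ≡-Reasoning
  only : ∀ i (f : VSet (suc m)) → count (λ v → does (inCopy? i v) ∧ f v) ≡ count (copy i f)
  only 0F f rewrite count-∅ m = +-identityʳ _
  only 1F f rewrite count-∅ m = +-identityʳ _
  only 2F f rewrite count-∅ m = refl

countTwoCopies-≤ : ∀ {m} i j (X : List (SVertex m)) → countTwoCopies i j X ≤ countCopy i X + countCopy j X
countTwoCopies-≤ i j []      = z≤n
countTwoCopies-≤ i j (v ∷ X) with inCopy? i v | inCopy? j v
... | yes _ | no _  = s≤s (countTwoCopies-≤ i j X)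
... | yes _ | yes _ = s≤s (≤-trans (countTwoCopies-≤ i j X) (+-monoʳ-≤ (countCopy i X) (n≤1+n _)))
... | no _  | yes _ = ≤-trans (s≤s (countTwoCopies-≤ i j X)) (≤-reflexive (sym (+-suc (countCopy i X) _)))
... | no _  | no _  = countTwoCopies-≤ i j X

countTwoCopies-same : ∀ {m} i (X : List (SVertex m)) → countTwoCopies i i X ≡ countCopy i X
countTwoCopies-same i X =
  cong length (filter-≐ (λ v → inCopy? i v ⊎-dec inCopy? i v) (inCopy? i) (reduce , inj₁) X)

-- Copies of a mutual-visibility set given as a list

module _ (k : ℕ) (X : List (SVertex (4 + k))) (u : Unique X) (M : IsMutualVisibilitySet (SAdj (4 + k)) X) where

  private
    g = 3 ^ (1 + k)
    f = among X
    open Copies (level k) f (mv-among M)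

    3≤g : 3 ≤ g
    3≤g = m≤m*n 3 (3 ^ k) ⦃ m^n≢0 3 k ⦄

  copies-equal : length X ≡ 3 ^ (2 + k) + 3 → ∀ i → countCopy i X ≡ 3 ^ (1 + k) + 1
  copies-equal e i with balanced-or-small 3≤g | perm-from i
  ... | inj₂ l | _ = ⊥-elim (<-irrefl total l)
    where
    total : count f ≡ 3 + 3g
    total = begin
      count f       ≡⟨ sym (length-count u) ⟩
      length X      ≡⟨ e ⟩
      3 * g + 3     ≡⟨ +-comm (3 * g) 3 ⟩
      3 + 3 * g     ≡⟨ cong (3 +_) (sym (tripled g)) ⟩
      3 + 3g        ∎
      where open ≡-Reasoning
  ... | inj₁ b | j , l , π = trans (countCopy-count u i) (trans (≤-antisym (b i) lower) (+-comm 1 g))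
    where
    arith : ∀ g → 1 + g + (1 + g + (1 + g)) ≡ 3 * g + 3
    arith = solve-∀
    lower : 1 + g ≤ count (copy i f)
    lower = +-cancelʳ-≤ (1 + g + (1 + g)) _ _ (begin
      1 + g + (1 + g + (1 + g))                                            ≡⟨ arith g ⟩
      3 * g + 3                                                            ≡⟨ sym e ⟩
      length X                                                             ≡⟨ length-count u ⟩
      count f                                                              ≡⟨ count-perm π f ⟩
      count (copy i f) + (count (copy j f) + count (copy l f))             ≤⟨ +-monoʳ-≤ (count (copy i f)) (+-mono-≤ (b j) (b l)) ⟩
      count (copy i f) + (1 + g + (1 + g))                                 ∎)
      where open ≤-Reasoning

  two-copies : ∀ i j → countTwoCopies i j X ≤ 2 * 3 ^ (1 + k) + 4
  two-copies i j with i ≟ j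
  -- Here only one copy is counted, and its own bound 3 + g is enough.
  ... | yes refl = begin
    countTwoCopies i i X        ≡⟨ countTwoCopies-same i X ⟩
    countCopy i X               ≡⟨ countCopy-count u i ⟩
    count (copy i f)            ≤⟨ Level.mv-bound (level k) (mvᶜ i) ⟩
    3 + g                       ≤⟨ +-mono-≤ (n≤1+n 3) (m≤m+n g (g + 0)) ⟩
    4 + 2 * g                   ≡⟨ +-comm 4 (2 * g) ⟩
    2 * g + 4                   ∎
    where open ≤-Reasoning
  ... | no n = begin
    countTwoCopies i j X                       ≤⟨ countTwoCopies-≤ i j X ⟩
    countCopy i X + countCopy j X              ≡⟨ cong₂ _+_ (countCopy-count u i) (countCopy-count u j) ⟩
    count (copy i f) + count (copy j f)        ≤⟨ pair-bound (third-perm n) ⟩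
    4 + (g + g)                                ≡⟨ arith g ⟩
    2 * g + 4                                  ∎
    where
    open ≤-Reasoning
    arith : ∀ g → 4 + (g + g) ≡ 2 * g + 4
    arith = solve-∀

isMu-S : ∀ (n : ℕ) → 2 ≤ n → IsMu (SAdj n) (3 ^ (n ∸ 2) + 3)
isMu-S (suc zero) (s≤s ())
-- The levels start at S³, so the upper bound in S² comes from a search of its own.
isMu-S (suc (suc zero)) _ =
  isMu witness₂ (from-yes (mv? witness₂)) refl λ {h} mv → bound exh-2 h mv λ _ _ → []
isMu-S (suc (suc (suc k))) _ =
  isMu (witness all k) (witness-mv k all) (count-all k)
    λ {h} mv → ≤-trans (Level.mv-bound (level k) mv) (≤-reflexive (+-comm 3 (3 ^ (1 + k))))

theorem4p4 : (∀ (n : ℕ) → 2 ≤ n → IsMu (SAdj n) (3 ^ (n ∸ 2) + 3))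
    × (∀ (n : ℕ) → 4 ≤ n → (X : List (SVertex n)) → Unique X →
    IsMutualVisibilitySet (SAdj n) X → length X ≡ 3 ^ (n ∸ 2) + 3 →
    ∀ (i : Fin 3) → countCopy i X ≡ 3 ^ (n ∸ 3) + 1)
    × (∀ (n : ℕ) → 4 ≤ n → (X : List (SVertex n)) → Unique X →
    IsMutualVisibilitySet (SAdj n) X →
    ∀ (i j : Fin 3) → countTwoCopies i j X ≤ 2 * 3 ^ (n ∸ 3) + 4)
theorem4p4 =
  isMu-S ,
  (λ { (suc (suc (suc (suc k)))) (s≤s (s≤s (s≤s (s≤s _)))) → copies-equal k }) ,
  (λ { (suc (suc (suc (suc k)))) (s≤s (s≤s (s≤s (s≤s _)))) → two-copies k })
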